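{- $$F_{312}(x,y)=\frac{1-x^2+x^2y-\sqrt{1+2x^2-2x^2y+x^4-2x^4y+x^4y^2-4x}}{2x(1+xy-x)}.$$
   Context: The pattern $312$ is written without dashes, so an occurrence of $312$ in $\pi=\pi_1\cdots\pi_n\in S_n$ is a position $i$ with $\pi_{i+1}<\pi_{i+2}<\pi_i$. A permutation is $1\text{ - }3\text{ - }2$-avoiding if there are no positions $a<b<c$ with $\pi_a<\pi_c<\pi_b$. $f_{\tau;r}(n)$ is the number of $1\text{ - }3\text{ - }2$-avoiding permutations in $S_n$ containing exactly $r$ occurrences of $\tau$ (with $S_0$ consisting of the empty permutation), and $F_\tau(x,y)=\sum_{n,r\ge 0} f_{\tau;r}(n)x^ny^r$, a formal power series in $x$ with coefficients in $\mathbb Z[y]$. The square root denotes the formal power series in $x$ with constant term $1$. -}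

module Defs where

open import Algebra.Bundles.Raw using (RawRing)
import Algebra.Definitions.RawSemiring as RawSemiringDefinitions
open import Algebra.Properties.Monoid.Sum using (sum-cong-≗; sum-replicate-zero)
open import Data.Bool.Base using (true; false; if_then_else_)
open import Data.Fin.Base as Fin using (Fin; toℕ)
import Data.Fin.Properties as Fin
open import Data.Integer.Base as ℤ using (ℤ; 0ℤ)
import Data.Integer.Properties as ℤ
open import Data.List.Base as List using (List)
open import Data.List.Properties using (filter-none)
import Data.List.Relation.Unary.All as ListAll
open import Data.Nat.Base as ℕ using (ℕ; zero; suc; _∸_; z≤n; s≤s)
import Data.Nat.Properties as ℕ
open import Data.Product using (_×_; _,_; ∃-syntax)
open import Data.Vec.Base using (Vec; []; _∷_; lookup)
open import Data.Vec.Relation.Unary.AllPairs using (allPairs?)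
open import Data.Vec.Relation.Unary.Unique.Propositional using (Unique)
open import Function.Base using (_$_)
open import Level using (0ℓ)
open import Relation.Binary.PropositionalEquality
open import Relation.Nullary using (¬_; Dec; does; yes; no; ¬?; _×-dec_)

-- Permutations of an n-element set are given in one-line notation:
-- words of length n over Fin n with pairwise distinct letters.

Word : ℕ → Set
Word n = Vec (Fin n) n

IsPermutation : ∀ {n} → Word n → Set
IsPermutation π = Unique π

Avoids-1-3-2 : ∀ {n} → Word n → Set
Avoids-1-3-2 {n} π = ¬ (∃[ a ] ∃[ b ] ∃[ c ]
  a Fin.< b × b Fin.< c ×
  lookup π a Fin.< lookup π c × lookup π c Fin.< lookup π b)

-- The pattern has no dashes, so only three consecutive letters count.
occ₃₁₂ : ∀ {n m} → Vec (Fin n) m → ℕ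
occ₃₁₂ (a ∷ w@(b ∷ c ∷ _)) =
  (if does (b Fin.<? c ×-dec c Fin.<? a) then 1 else 0) ℕ.+ occ₃₁₂ w
occ₃₁₂ _ = 0

Counted : ∀ {n} → ℕ → Word n → Set
Counted r π = IsPermutation π × Avoids-1-3-2 π × occ₃₁₂ π ≡ r

counted? : ∀ {n} r (π : Word n) → Dec (Counted r π)
counted? r π =
  allPairs? (λ i j → ¬? (i Fin.≟ j)) π ×-dec
  ¬? (Fin.any? λ a → Fin.any? λ b → Fin.any? λ c →
    a Fin.<? b ×-dec b Fin.<? c ×-dec
    lookup π a Fin.<? lookup π c ×-dec lookup π c Fin.<? lookup π b) ×-dec
  (occ₃₁₂ π ℕ.≟ r)

-- Every vector over Fin n of length m, each listed exactly once.
allVecs : ∀ n m → List (Vec (Fin n) m)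
allVecs n zero    = List.[ [] ]
allVecs n (suc m) = List.cartesianProductWith _∷_ (List.allFin n) (allVecs n m)

f₃₁₂ : (r n : ℕ) → ℕ
f₃₁₂ r n = List.length (List.filter (counted? r) (allVecs n n))

occ₃₁₂≤length : ∀ {n m} (w : Vec (Fin n) m) → occ₃₁₂ w ℕ.≤ m
occ₃₁₂≤length []           = z≤n
occ₃₁₂≤length (_ ∷ [])     = z≤n
occ₃₁₂≤length (_ ∷ _ ∷ []) = z≤n
occ₃₁₂≤length (a ∷ w@(b ∷ c ∷ _)) =
  ℕ.+-mono-≤ (indicator≤1 (does (b Fin.<? c ×-dec c Fin.<? a)))
             (occ₃₁₂≤length w)
  where
  indicator≤1 : ∀ t → (if t then 1 else 0) ℕ.≤ 1
  indicator≤1 true  = s≤s z≤n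
  indicator≤1 false = z≤n

f₃₁₂-vanishes : ∀ n r → n ℕ.< r → f₃₁₂ r n ≡ 0
f₃₁₂-vanishes n r n<r = cong List.length $ filter-none (counted? r) $
  ListAll.universal
    (λ { π (_ , _ , refl) → ℕ.<⇒≱ n<r (occ₃₁₂≤length π) })
    (allVecs n n)

module PowerSeries {c ℓ} (R : RawRing c ℓ) where
  private module R = RawRing R
  open RawSemiringDefinitions R.rawSemiring using (sum)

  -- a n is the coefficient of the n-th power of the variable.
  Series : Set c
  Series = ℕ → R.Carrier

  constant : R.Carrier → Series
  constant a zero    = a
  constant a (suc _) = R.0#

  indeterminate : Series
  indeterminate 1 = R.1#
  indeterminate _ = R.0#

  cauchyProduct : Series → Series → Series
  cauchyProduct a b n = sum {suc n} λ i → a (toℕ i) R.* b (n ∸ toℕ i)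

  rawRing : RawRing c ℓ
  rawRing = record
    { Carrier = Series
    ; _≈_     = λ a b → ∀ n → a n R.≈ b n
    ; _+_     = λ a b n → a n R.+ b n
    ; _*_     = cauchyProduct
    ; -_      = λ a n → R.- a n
    ; 0#      = λ _ → R.0#
    ; 1#      = constant R.1#
    }

module ℤ⟦y⟧ where
  open PowerSeries ℤ.+-*-rawRing public
  open RawRing rawRing public

-- Polynomials over ℤ are the power series that vanish from some degree on.
-- The bound need not be sharp, and equality compares coefficients only.
record Polynomial : Set where
  field
    coeff    : ℕ → ℤ
    bound    : ℕ
    vanishes : ∀ r → bound ℕ.≤ r → coeff r ≡ 0ℤ

open Polynomial

ℤ[y] : RawRing 0ℓ 0ℓ
ℤ[y] = record
  { Carrier = Polynomial
  ; _≈_     = λ p q → coeff p ℤ⟦y⟧.≈ coeff q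
  ; _+_     = add
  ; _*_     = mul
  ; -_      = λ p → record
    { coeff    = ℤ⟦y⟧.- coeff p
    ; bound    = bound p
    ; vanishes = λ r b≤r → cong ℤ.-_ (vanishes p r b≤r)
    }
  ; 0#      = record
    { coeff = ℤ⟦y⟧.0# ; bound = 0 ; vanishes = λ _ _ → refl }
  ; 1#      = record
    { coeff = ℤ⟦y⟧.1# ; bound = 1 ; vanishes = λ { (suc _) _ → refl } }
  }
  where
  add : Polynomial → Polynomial → Polynomial
  add p q = record
    { coeff    = coeff p ℤ⟦y⟧.+ coeff q
    ; bound    = bound p ℕ.⊔ bound q
    ; vanishes = λ r b≤r → cong₂ ℤ._+_
        (vanishes p r (ℕ.m⊔n≤o⇒m≤o (bound p) (bound q) b≤r))
        (vanishes q r (ℕ.m⊔n≤o⇒n≤o (bound p) (bound q) b≤r))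
    }

  mul : Polynomial → Polynomial → Polynomial
  mul p q = record
    { coeff    = coeff p ℤ⟦y⟧.* coeff q
    ; bound    = bound p ℕ.+ bound q
    ; vanishes = λ r b≤r → trans
        (sum-cong-≗ ℤ.+-0-monoid {suc r} λ i → term≡0 r (toℕ i) b≤r)
        (sum-replicate-zero ℤ.+-0-monoid (suc r))
    }
    where
    term≡0 : ∀ r i → bound p ℕ.+ bound q ℕ.≤ r →
             coeff p i ℤ.* coeff q (r ∸ i) ≡ 0ℤ
    term≡0 r i b≤r with bound p ℕ.≤? i
    ... | yes bp≤i = trans (cong (ℤ._* coeff q (r ∸ i)) (vanishes p i bp≤i))
                           (ℤ.*-zeroˡ (coeff q (r ∸ i)))
    ... | no  bp≰i = trans (cong (coeff p i ℤ.*_) (vanishes q (r ∸ i) bq≤r∸i))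
                           (ℤ.*-zeroʳ (coeff p i))
      where
      bq≤r∸i : bound q ℕ.≤ r ∸ i
      bq≤r∸i = ℕ.m+n≤o⇒m≤o∸n (bound q) (ℕ.≤-trans
        (ℕ.+-monoʳ-≤ (bound q) (ℕ.<⇒≤ (ℕ.≰⇒> bp≰i)))
        (ℕ.≤-trans (ℕ.≤-reflexive (ℕ.+-comm (bound q) (bound p))) b≤r))

ℤ[y]⟦x⟧ : RawRing 0ℓ 0ℓ
ℤ[y]⟦x⟧ = PowerSeries.rawRing ℤ[y]

open RawRing ℤ[y]⟦x⟧ public
open RawSemiringDefinitions rawSemiring public
  using (_^_) renaming (_×_ to _·_)

infixl 6 _-_
_-_ : Carrier → Carrier → Carrier
a - b = a + (- b)

x : Carrier
x = PowerSeries.indeterminate ℤ[y]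

y : Carrier
y = PowerSeries.constant ℤ[y] record
  { coeff    = ℤ⟦y⟧.indeterminate
  ; bound    = 2
  ; vanishes = λ { (suc (suc _)) _ → refl ; 1 (s≤s ()) }
  }

F₃₁₂ : Carrier
F₃₁₂ n = record
  { coeff    = λ r → ℤ.+ f₃₁₂ r n
  ; bound    = suc n
  ; vanishes = λ r n<r → cong ℤ.+_ (f₃₁₂-vanishes n r n<r)
  }

-- s is the unique square root of d with constant term 1.
_IsSquareRootOf_ : Carrier → Carrier → Set
s IsSquareRootOf d = IsRoot s × (∀ t → IsRoot t → t ≈ s)
  where
  IsRoot : Carrier → Set
  IsRoot t = t * t ≈ d × RawRing._≈_ ℤ[y] (t 0) (RawRing.1# ℤ[y])

-- Fractions whose denominator is not a unit (it may be divisible by x):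
-- q is the unique series with q * b ≈ a.
_IsQuotientOf_By_ : Carrier → Carrier → Carrier → Set
q IsQuotientOf a By b = q * b ≈ a × (∀ p → p * b ≈ a → p ≈ q)

-- A nonempty 1-3-2-avoiding permutation with maximum n is a word σ n τ in which
-- every letter of σ exceeds every letter of τ.  An occurrence of 312 in it lies
-- in σ, lies in τ, or is n τ₁ τ₂ with τ₁ < τ₂.  Let F count the avoiders by
-- occurrences, and let G count them by occurrences plus one if the word begins
-- with an ascent.  Splitting at the maximum gives F = 1 + x F G.  The first two
-- letters of σ n τ are an ascent iff those of σ are, except that a single letter
-- σ also yields one; hence G = 1 + x (G + x (y − 1)) G.  Eliminating G leaves the
-- quadratic equation F = 1 + x F² + x² (y − 1) (F² − F), and completing the square
-- in it turns 1 − x² + x² y − 2 x (1 + x y − x) F into a square root of the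
-- discriminant.  Both uniqueness claims hold because neither x nor a series with
-- constant term 2 is a zero divisor.

module Submission where

open import Defs using (module PowerSeries; Word; IsPermutation; Avoids-1-3-2;
  occ₃₁₂; Counted; counted?; allVecs)
open import Algebra.Bundles using (CommutativeRing)
open import Algebra.Bundles.Raw using (RawRing)
open import Algebra.Core using (Op₁; Op₂)
import Algebra.Definitions.RawSemiring as RawSemiringDefinitions
open import Algebra.Morphism.Structures using (IsRingMonomorphism)
open import Algebra.Structures using (IsCommutativeRing)
open import Data.Fin.Base as Fin using (Fin; toℕ; fromℕ<; zero; suc)
import Data.Fin.Properties as Fin
open import Data.Integer.Base as ℤ using (ℤ)
import Data.Integer.Properties as ℤ
open import Data.List.Base as List
  using (List; []; _∷_; [_]; _++_; map; concat; tabulate; cartesianProductWith; length; downFrom)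
import Data.List.Properties as List
open import Data.List.Relation.Binary.Permutation.Propositional as ↭ using (_↭_)
open import Data.List.Relation.Unary.All as All using (All; []; _∷_)
open import Data.Nat.Base as ℕ using (ℕ; zero; suc; _∸_; _≤_; _<_; z≤n; s≤s; s≤s⁻¹)
import Data.Nat.Properties as ℕ
open import Data.Product using (∃-syntax; _×_; _,_; proj₁; proj₂)
open import Function.Base using (_∘_; id)
open import Level using (0ℓ; _⊔_)
open import Relation.Binary.Core using (Rel)
open import Relation.Binary.PropositionalEquality as ≡ using (_≡_; _≢_; cong; cong₂; subst)
open import Relation.Nullary using (¬_; Dec; does; yes; no; contradiction; _×-dec_)

IsNonZeroDivisor : ∀ {c ℓ} (R : CommutativeRing c ℓ) → CommutativeRing.Carrier R → Set (c ⊔ ℓ)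
IsNonZeroDivisor R a = ∀ r → r * a ≈ 0# → r ≈ 0#
  where open CommutativeRing R

*-1+1 : ∀ {c ℓ} (R : CommutativeRing c ℓ) → let open CommutativeRing R in
  ∀ a → a * (1# + 1#) ≈ a + a
*-1+1 R a = trans (distribˡ a 1# 1#) (+-cong (*-identityʳ a) (*-identityʳ a))
  where open CommutativeRing R

-- Power series over a commutative ring form a commutative ring.

module SeriesRing {c ℓ} (R : CommutativeRing c ℓ) where
  private
    module R = CommutativeRing R
  open PowerSeries R.rawRing using (Series; constant; indeterminate; cauchyProduct)
  open R using (_≈_)
  open import Algebra.Properties.CommutativeSemigroup R.+-commutativeSemigroup
    using (interchange; x∙yz≈y∙xz)
  open import Relation.Binary.Reasoning.Setoid R.setoid

  infix 4 _≋_
  _≋_ : Series → Series → Set ℓ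
  a ≋ b = ∀ n → a n ≈ b n

  infixl 7 _⊛_
  _⊛_ : Series → Series → Series
  _⊛_ = cauchyProduct

  infixl 6 _⊞_
  _⊞_ : Series → Series → Series
  (a ⊞ b) n = a n R.+ b n

  infixr 8 _◂_
  _◂_ : R.Carrier → Series → Series
  (r ◂ a) n = r R.* a n

  tail : Series → Series
  tail a n = a (suc n)

  -- The sum behind `⊛` unfolds definitionally: `(a ⊛ b) (suc n)` is
  -- `a 0 R.* b (suc n) R.+ (tail a ⊛ b) n`. The ring laws are proved by induction on the degree
  -- along this recursion.
  ⊛-cong : ∀ {a a′ b b′} → a ≋ a′ → b ≋ b′ → a ⊛ b ≋ a′ ⊛ b′
  ⊛-cong p q zero    = R.+-congʳ (R.*-cong (p 0) (q 0))
  ⊛-cong p q (suc n) = R.+-cong (R.*-cong (p 0) (q (suc n))) (⊛-cong (λ i → p (suc i)) q n)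

  ⊛-zeroˡ : ∀ b → (λ _ → R.0#) ⊛ b ≋ λ _ → R.0#
  ⊛-zeroˡ b zero    = R.trans (R.+-identityʳ _) (R.zeroˡ _)
  ⊛-zeroˡ b (suc n) =
    R.trans (R.+-cong (R.zeroˡ _) (⊛-zeroˡ b n)) (R.+-identityˡ _)

  constant-⊛ : ∀ r b → constant r ⊛ b ≋ r ◂ b
  constant-⊛ r b zero    = R.+-identityʳ _
  constant-⊛ r b (suc n) = R.trans (R.+-congˡ (⊛-zeroˡ b n)) (R.+-identityʳ _)

  indeterminate-⊛₀ : ∀ b → (indeterminate ⊛ b) 0 ≈ R.0#
  indeterminate-⊛₀ b = R.trans (R.+-identityʳ _) (R.zeroˡ _)

  tail-indeterminate-⊛ : ∀ b → tail (indeterminate ⊛ b) ≋ b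
  tail-indeterminate-⊛ b n = begin
    R.0# R.* b (suc n) R.+ (tail indeterminate ⊛ b) n
      ≈⟨ R.+-cong (R.zeroˡ _) (⊛-cong {b = b} tail≋1 (λ _ → R.refl) n) ⟩
    R.0# R.+ (constant R.1# ⊛ b) n
      ≈⟨ R.+-identityˡ _ ⟩
    (constant R.1# ⊛ b) n
      ≈⟨ constant-⊛ R.1# b n ⟩
    R.1# R.* b n
      ≈⟨ R.*-identityˡ _ ⟩
    b n ∎
    where
    tail≋1 : tail indeterminate ≋ constant R.1#
    tail≋1 zero    = R.refl
    tail≋1 (suc _) = R.refl

  ⊛-distribʳ : ∀ c a b → (a ⊞ b) ⊛ c ≋ (a ⊛ c) ⊞ (b ⊛ c)
  ⊛-distribʳ c a b zero    = R.trans
    (R.+-cong (R.distribʳ _ _ _) (R.sym (R.+-identityˡ _)))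
    (interchange _ _ _ _)
  ⊛-distribʳ c a b (suc n) = R.trans
    (R.+-cong (R.distribʳ _ _ _) (⊛-distribʳ c (tail a) (tail b) n))
    (interchange _ _ _ _)

  ◂-⊛ : ∀ r a b → (r ◂ a) ⊛ b ≋ r ◂ (a ⊛ b)
  ◂-⊛ r a b zero    = begin
    r R.* a 0 R.* b 0 R.+ R.0#   ≈⟨ R.+-identityʳ _ ⟩
    r R.* a 0 R.* b 0            ≈⟨ R.*-assoc _ _ _ ⟩
    r R.* (a 0 R.* b 0)          ≈⟨ R.*-congˡ (R.+-identityʳ _) ⟨
    r R.* (a 0 R.* b 0 R.+ R.0#) ∎
  ◂-⊛ r a b (suc n) = R.trans
    (R.+-cong (R.*-assoc _ _ _) (◂-⊛ r (tail a) b n))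
    (R.sym (R.distribˡ _ _ _))

  -- By the recursion `tail (a ⊛ b)` is `(a 0 ◂ tail b) ⊞ (tail a ⊛ b)`; distributivity and the
  -- scalar rule then expose the induction hypothesis for `tail a`.
  ⊛-assoc : ∀ a b c → (a ⊛ b) ⊛ c ≋ a ⊛ (b ⊛ c)
  ⊛-assoc a b c zero    = R.+-congʳ (begin
    (a 0 R.* b 0 R.+ R.0#) R.* c 0 ≈⟨ R.*-congʳ (R.+-identityʳ _) ⟩
    a 0 R.* b 0 R.* c 0            ≈⟨ R.*-assoc _ _ _ ⟩
    a 0 R.* (b 0 R.* c 0)          ≈⟨ R.*-congˡ (R.+-identityʳ _) ⟨
    a 0 R.* (b 0 R.* c 0 R.+ R.0#) ∎)
  ⊛-assoc a b c (suc n) = begin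
    (a 0 R.* b 0 R.+ R.0#) R.* c (suc n) R.+ (((a 0 ◂ tail b) ⊞ (tail a ⊛ b)) ⊛ c) n
      ≈⟨ R.+-cong (R.trans (R.*-congʳ (R.+-identityʳ _)) (R.*-assoc _ _ _))
                  (⊛-distribʳ c (a 0 ◂ tail b) (tail a ⊛ b) n) ⟩
    a 0 R.* (b 0 R.* c (suc n)) R.+ (((a 0 ◂ tail b) ⊛ c) n R.+ ((tail a ⊛ b) ⊛ c) n)
      ≈⟨ R.+-congˡ (R.+-cong (◂-⊛ (a 0) (tail b) c n) (⊛-assoc (tail a) b c n)) ⟩
    a 0 R.* (b 0 R.* c (suc n)) R.+ (a 0 R.* (tail b ⊛ c) n R.+ (tail a ⊛ (b ⊛ c)) n)
      ≈⟨ R.+-assoc _ _ _ ⟨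
    a 0 R.* (b 0 R.* c (suc n)) R.+ a 0 R.* (tail b ⊛ c) n R.+ (tail a ⊛ (b ⊛ c)) n
      ≈⟨ R.+-congʳ (R.distribˡ _ _ _) ⟨
    a 0 R.* (b 0 R.* c (suc n) R.+ (tail b ⊛ c) n) R.+ (tail a ⊛ (b ⊛ c)) n ∎

  -- The recursion peels only the left factor. Commuting `tail a` past `b` lets it peel `b` too,
  -- leaving `tail b ⊛ tail a` two degrees lower; hence the two base cases.
  ⊛-comm : ∀ a b → a ⊛ b ≋ b ⊛ a
  ⊛-comm a b zero          = R.+-congʳ (R.*-comm _ _)
  ⊛-comm a b (suc zero)    = begin
    a 0 R.* b 1 R.+ (a 1 R.* b 0 R.+ R.0#)
      ≈⟨ x∙yz≈y∙xz _ _ _ ⟩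
    a 1 R.* b 0 R.+ (a 0 R.* b 1 R.+ R.0#)
      ≈⟨ R.+-cong (R.*-comm _ _) (R.+-congʳ (R.*-comm _ _)) ⟩
    b 0 R.* a 1 R.+ (b 1 R.* a 0 R.+ R.0#) ∎
  ⊛-comm a b (suc (suc n)) = begin
    a 0 R.* b (suc (suc n)) R.+ (tail a ⊛ b) (suc n)
      ≈⟨ R.+-congˡ (⊛-comm (tail a) b (suc n)) ⟩
    a 0 R.* b (suc (suc n)) R.+ (b 0 R.* a (suc (suc n)) R.+ (tail b ⊛ tail a) n)
      ≈⟨ x∙yz≈y∙xz _ _ _ ⟩
    b 0 R.* a (suc (suc n)) R.+ (a 0 R.* b (suc (suc n)) R.+ (tail b ⊛ tail a) n)
      ≈⟨ R.+-congˡ (R.+-congˡ (⊛-comm (tail b) (tail a) n)) ⟩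
    b 0 R.* a (suc (suc n)) R.+ (a ⊛ tail b) (suc n)
      ≈⟨ R.+-congˡ (⊛-comm a (tail b) (suc n)) ⟩
    b 0 R.* a (suc (suc n)) R.+ (tail b ⊛ a) (suc n) ∎

  ⊛-identityˡ : ∀ a → constant R.1# ⊛ a ≋ a
  ⊛-identityˡ a n = R.trans (constant-⊛ R.1# a n) (R.*-identityˡ _)

  commutativeRing : CommutativeRing c ℓ
  commutativeRing = record
    { Carrier = Series
    ; _≈_ = _≋_
    ; _+_ = _⊞_
    ; _*_ = _⊛_
    ; -_  = λ a n → R.- a n
    ; 0#  = λ _ → R.0#
    ; 1#  = constant R.1#
    ; isCommutativeRing = record
      { isRing = record
        { +-isAbelianGroup = record
          { isGroup = record
            { isMonoid = record
              { isSemigroup = record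
                { isMagma = record
                  { isEquivalence = record
                    { refl  = λ _ → R.refl
                    ; sym   = λ p n → R.sym (p n)
                    ; trans = λ p q n → R.trans (p n) (q n)
                    }
                  ; ∙-cong = λ p q n → R.+-cong (p n) (q n)
                  }
                ; assoc = λ _ _ _ _ → R.+-assoc _ _ _
                }
              ; identity = (λ _ _ → R.+-identityˡ _) , (λ _ _ → R.+-identityʳ _)
              }
            ; inverse = (λ _ _ → R.-‿inverseˡ _) , (λ _ _ → R.-‿inverseʳ _)
            ; ⁻¹-cong = λ p n → R.-‿cong (p n)
            }
          ; comm = λ _ _ _ → R.+-comm _ _
          }
        ; *-cong = ⊛-cong
        ; *-assoc = ⊛-assoc
        ; *-identity = ⊛-identityˡ
                     , λ a n → R.trans (⊛-comm a (constant R.1#) n) (⊛-identityˡ a n)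
        ; distrib = (λ a b c n → R.trans (⊛-comm a (b ⊞ c) n)
                      (R.trans (⊛-distribʳ a b c n)
                               (R.+-cong (⊛-comm b a n) (⊛-comm c a n))))
                  , ⊛-distribʳ
        }
      ; *-comm = ⊛-comm
      }
    }

  indeterminate-nonZeroDivisor : IsNonZeroDivisor commutativeRing indeterminate
  indeterminate-nonZeroDivisor d dx≋0 n = begin
    d n                             ≈⟨ tail-indeterminate-⊛ d n ⟨
    (indeterminate ⊛ d) (suc n)     ≈⟨ ⊛-comm indeterminate d (suc n) ⟩
    (d ⊛ indeterminate) (suc n)     ≈⟨ dx≋0 (suc n) ⟩
    R.0#                            ∎

  -- If `d` annihilates `b`, its constant term vanishes by regularity of `b 0`; then `tail d`
  -- annihilates `b` as well, and the argument repeats for the next coefficient.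
  ⊛-nonZeroDivisor : ∀ b → IsNonZeroDivisor R (b 0) → IsNonZeroDivisor commutativeRing b
  ⊛-nonZeroDivisor b regular d db≋0 = vanishes
    where
    d₀≈0 : d 0 ≈ R.0#
    d₀≈0 = regular (d 0) (R.trans (R.sym (R.+-identityʳ _)) (db≋0 0))
    tail≋0 : tail d ⊛ b ≋ λ _ → R.0#
    tail≋0 n = begin
      (tail d ⊛ b) n                        ≈⟨ R.+-identityˡ _ ⟨
      R.0# R.+ (tail d ⊛ b) n               ≈⟨ R.+-congʳ (R.zeroˡ _) ⟨
      R.0# R.* b (suc n) R.+ (tail d ⊛ b) n ≈⟨ R.+-congʳ (R.*-congʳ d₀≈0) ⟨
      d 0 R.* b (suc n) R.+ (tail d ⊛ b) n  ≈⟨ db≋0 (suc n) ⟩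
      R.0#                                  ∎
    vanishes : d ≋ λ _ → R.0#
    vanishes zero    = d₀≈0
    vanishes (suc n) = ⊛-nonZeroDivisor b regular (tail d) tail≋0 n

  HasConstantTerm1 : Series → Set ℓ
  HasConstantTerm1 a = a 0 ≈ R.1#

  HasConstantTerm1-resp : ∀ {a b} → a ≋ b → HasConstantTerm1 b → HasConstantTerm1 a
  HasConstantTerm1-resp a≋b b₀≈1 = R.trans (a≋b 0) b₀≈1

  HasConstantTerm1-1+x* : ∀ a → HasConstantTerm1 (constant R.1# ⊞ (indeterminate ⊛ a))
  HasConstantTerm1-1+x* a = R.trans (R.+-congˡ (indeterminate-⊛₀ a)) (R.+-identityʳ _)

  -- The constant term of `a ⊞ b` is 2, so regularity of 2 among the coefficients suffices.
  HasConstantTerm1-⊞-nonZeroDivisor :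
    IsNonZeroDivisor R (R.1# R.+ R.1#) → ∀ {a b} → HasConstantTerm1 a → HasConstantTerm1 b →
    IsNonZeroDivisor commutativeRing (a ⊞ b)
  HasConstantTerm1-⊞-nonZeroDivisor 2-regular {a} {b} a₀≈1 b₀≈1 =
    ⊛-nonZeroDivisor (a ⊞ b) λ r r[a+b]₀≈0 →
      2-regular r (R.trans (R.*-congˡ (R.sym (R.+-cong a₀≈1 b₀≈1))) r[a+b]₀≈0)

-- A ring solver with integer coefficients over any commutative ring.

module IntegerCoefficients {c ℓ} (R : CommutativeRing c ℓ) where
  open CommutativeRing R
  open import Algebra.Properties.Ring ring using (-‿distribˡ-*; -0#≈0#; -‿involutive)
  open import Algebra.Properties.AbelianGroup +-abelianGroup using (⁻¹-∙-comm)
  open import Algebra.Properties.CommutativeSemigroup +-commutativeSemigroup using (interchange)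
  open import Algebra.Properties.Monoid.Mult.TCOptimised +-monoid
    using (1+×; ×-homo-+) renaming (_×_ to _·_)
  open import Algebra.Solver.Ring.AlmostCommutativeRing
    using (fromCommutativeRing; _-Raw-AlmostCommutative⟶_)
  open import Data.Integer.Base using (+_; -[1+_]; _⊖_)
  open import Data.Maybe.Base using (Maybe; just; nothing)
  open import Relation.Binary.Reasoning.Setoid setoid

  -- The unique ring homomorphism from ℤ, by which the solver evaluates its constants. With this
  -- `_·_`, `1 · 1#` reduces to `1#`, so `con (+ 1)` stands for `1#` itself.
  ⟦_⟧ : ℤ → Carrier
  ⟦ + n      ⟧ = n · 1#
  ⟦ -[1+ n ] ⟧ = - (suc n · 1#)

  -‿homo : ∀ i → ⟦ ℤ.- i ⟧ ≈ - ⟦ i ⟧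
  -‿homo (+ zero)  = sym -0#≈0#
  -‿homo (+ suc n) = refl
  -‿homo -[1+ n ]  = sym (-‿involutive _)

  ⊖-homo : ∀ m n → ⟦ m ⊖ n ⟧ ≈ m · 1# - n · 1#
  ⊖-homo zero    zero    = sym (-‿inverseʳ _)
  ⊖-homo zero    (suc n) = sym (+-identityˡ _)
  ⊖-homo (suc m) zero    = sym (trans (+-congˡ -0#≈0#) (+-identityʳ _))
  ⊖-homo (suc m) (suc n) = begin
    ⟦ suc m ⊖ suc n ⟧                      ≡⟨ cong ⟦_⟧ (ℤ.[1+m]⊖[1+n]≡m⊖n m n) ⟩
    ⟦ m ⊖ n ⟧                              ≈⟨ ⊖-homo m n ⟩
    m · 1# - n · 1#                        ≈⟨ +-identityˡ _ ⟨
    0# + (m · 1# - n · 1#)                 ≈⟨ +-congʳ (-‿inverseʳ _) ⟨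
    1# - 1# + (m · 1# - n · 1#)            ≈⟨ interchange _ _ _ _ ⟩
    (1# + m · 1#) + (- 1# - n · 1#)        ≈⟨ +-congˡ (⁻¹-∙-comm _ _) ⟩
    (1# + m · 1#) - (1# + n · 1#)          ≈⟨ +-cong (1+× m 1#) (-‿cong (1+× n 1#)) ⟨
    suc m · 1# - suc n · 1#                ∎

  +-homo : ∀ i j → ⟦ i ℤ.+ j ⟧ ≈ ⟦ i ⟧ + ⟦ j ⟧
  +-homo (+ m)    (+ n)    = ×-homo-+ 1# m n
  +-homo (+ m)    -[1+ n ] = ⊖-homo m (suc n)
  +-homo -[1+ m ] (+ n)    = trans (⊖-homo n (suc m)) (+-comm _ _)
  +-homo -[1+ m ] -[1+ n ] = begin
    - (suc (suc (m ℕ.+ n)) · 1#)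
      ≡⟨ cong (λ k → - (k · 1#)) (ℕ.+-suc (suc m) n) ⟨
    - ((suc m ℕ.+ suc n) · 1#)   ≈⟨ -‿cong (×-homo-+ 1# (suc m) (suc n)) ⟩
    - (suc m · 1# + suc n · 1#)              ≈⟨ ⁻¹-∙-comm _ _ ⟨
    - (suc m · 1#) - suc n · 1#              ∎

  *-homo⁺ : ∀ n j → ⟦ + n ℤ.* j ⟧ ≈ n · 1# * ⟦ j ⟧
  *-homo⁺ zero    j = trans (reflexive (cong ⟦_⟧ (ℤ.*-zeroˡ j))) (sym (zeroˡ _))
  *-homo⁺ (suc n) j = begin
    ⟦ + suc n ℤ.* j ⟧              ≡⟨ cong ⟦_⟧ (ℤ.suc-* (+ n) j) ⟩
    ⟦ j ℤ.+ + n ℤ.* j ⟧            ≈⟨ +-homo j (+ n ℤ.* j) ⟩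
    ⟦ j ⟧ + ⟦ + n ℤ.* j ⟧          ≈⟨ +-cong (sym (*-identityˡ _)) (*-homo⁺ n j) ⟩
    1# * ⟦ j ⟧ + n · 1# * ⟦ j ⟧    ≈⟨ distribʳ _ _ _ ⟨
    (1# + n · 1#) * ⟦ j ⟧          ≈⟨ *-congʳ (1+× n 1#) ⟨
    suc n · 1# * ⟦ j ⟧             ∎

  *-homo : ∀ i j → ⟦ i ℤ.* j ⟧ ≈ ⟦ i ⟧ * ⟦ j ⟧
  *-homo (+ n)    j = *-homo⁺ n j
  *-homo -[1+ n ] j = begin
    ⟦ -[1+ n ] ℤ.* j ⟧         ≡⟨ cong ⟦_⟧ (ℤ.neg-distribˡ-* (+ suc n) j) ⟨
    ⟦ ℤ.- (+ suc n ℤ.* j) ⟧    ≈⟨ -‿homo (+ suc n ℤ.* j) ⟩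
    - ⟦ + suc n ℤ.* j ⟧        ≈⟨ -‿cong (*-homo⁺ (suc n) j) ⟩
    - (suc n · 1# * ⟦ j ⟧)     ≈⟨ -‿distribˡ-* _ _ ⟩
    - (suc n · 1#) * ⟦ j ⟧     ∎

  morphism : ℤ.+-*-rawRing -Raw-AlmostCommutative⟶ fromCommutativeRing R
  morphism = record
    { ⟦_⟧    = ⟦_⟧
    ; +-homo = +-homo
    ; *-homo = *-homo
    ; -‿homo = -‿homo
    ; 0-homo = refl
    ; 1-homo = refl
    }

  _≟_ : ∀ i j → Maybe (⟦ i ⟧ ≈ ⟦ j ⟧)
  i ≟ j with i ℤ.≟ j
  ... | yes i≡j = just (reflexive (cong ⟦_⟧ i≡j))
  ... | no _    = nothing

  open import Algebra.Solver.Ring ℤ.+-*-rawRing (fromCommutativeRing R) morphism _≟_ public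
    using (Polynomial; solve; _:=_; con; _:+_; _:*_; _:-_)

-- Solving the quadratic equation.

-- For power series, One is the property of having constant term 1.
module QuadraticFormula
  {c ℓ p} (R : CommutativeRing c ℓ)
  (x : CommutativeRing.Carrier R) (One : CommutativeRing.Carrier R → Set p)
  where
  open CommutativeRing R
  open RawSemiringDefinitions (RawRing.rawSemiring rawRing) using (_^_) renaming (_×_ to _·_)
  open IntegerCoefficients R using (solve; _:=_; con; _:+_; _:*_; _:-_; Polynomial)
  open import Algebra.Properties.Group +-group using (x∙y⁻¹≈ε⇒x≈y; x≈y⇒x∙y⁻¹≈ε)
  open import Data.Integer.Base using (+_)
  open import Relation.Binary.Reasoning.Setoid setoid

  private
    infixr 9 _:·_ _:^_
    -- Solver syntax following the recursions of `_·_` and `_^_`, so that evaluating an expression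
    -- gives back the intended term definitionally.
    _:·_ : ∀ {n} → ℕ → Polynomial n → Polynomial n
    zero  :· p = con (+ 0)
    suc k :· p = p :+ (k :· p)

    _:^_ : ∀ {n} → Polynomial n → ℕ → Polynomial n
    p :^ zero  = con (+ 1)
    p :^ suc k = p :* (p :^ k)

    :1 : ∀ {n} → Polynomial n
    :1 = con (+ 1)

    :denominator : ∀ {n} → Polynomial n → Polynomial n → Polynomial n
    :denominator x y = 2 :· x :* (:1 :+ x :* y :- x)

    :root : ∀ {n} → Polynomial n → Polynomial n → Polynomial n → Polynomial n
    :root x y f = :1 :- x :^ 2 :+ x :^ 2 :* y :- f :* :denominator x y

    :quadratic : ∀ {n} → Polynomial n → Polynomial n → Polynomial n → Polynomial n
    :quadratic x y f = f :- (:1 :+ x :* (f :* f) :+ x :* x :* (y :- :1) :* (f :* f :- f))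

  discriminant : Carrier → Carrier
  discriminant y =
    1# + 2 · x ^ 2 - 2 · x ^ 2 * y + x ^ 4 - 2 · x ^ 4 * y + x ^ 4 * y ^ 2 - 4 · x

  denominator : Carrier → Carrier
  denominator y = 2 · x * (1# + x * y - x)

  -- The quotient formula solved for the square root. It is also the derivative of the quadratic
  -- with respect to `f`.
  root : Carrier → Carrier → Carrier
  root y f = 1# - x ^ 2 + x ^ 2 * y - f * denominator y

  *-denominator : ∀ y f → f * denominator y ≈ 1# - x ^ 2 + x ^ 2 * y - root y f
  *-denominator y f = solve 2 (λ a b → b := a :- (a :- b)) refl _ _

  module _ {y f g : Carrier}
           (f-eq : f ≈ 1# + x * (f * g))
           (g-eq : g ≈ 1# + x * ((g + x * (y - 1#)) * g))
    where

    -- Multiplied by `x * f * f`, the equation for `g` contains `g` only through powers of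
    -- `x * f * g`, which the equation for `f` turns into `f - 1#`. The cofactors below record this
    -- elimination.
    quadratic : f - (1# + x * (f * f) + x * x * (y - 1#) * (f * f - f)) ≈ 0#
    quadratic = begin
      f - (1# + x * (f * f) + x * x * (y - 1#) * (f * f - f))
        ≈⟨ solve 4 (λ x y f g →
             :quadratic x y f
             := (:1 :- x :* x :* (y :- :1) :* f :- x :* f :* g) :* (f :- (:1 :+ x :* (f :* g)))
                :+ x :* f :* f :* (g :- (:1 :+ x :* ((g :+ x :* (y :- :1)) :* g))))
             refl x y f g ⟩
      (1# - x * x * (y - 1#) * f - x * f * g) * (f - (1# + x * (f * g)))
        + x * f * f * (g - (1# + x * ((g + x * (y - 1#)) * g)))
        ≈⟨ +-cong (*-congˡ (x≈y⇒x∙y⁻¹≈ε f-eq)) (*-congˡ (x≈y⇒x∙y⁻¹≈ε g-eq)) ⟩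
      (1# - x * x * (y - 1#) * f - x * f * g) * 0# + x * f * f * 0#
        ≈⟨ +-cong (zeroʳ _) (zeroʳ _) ⟩
      0# + 0#
        ≈⟨ +-identityʳ _ ⟩
      0# ∎

    -- Put `u = 1# + x * (y - 1#)` and `b = 1# + x * x * (y - 1#)`. The quadratic is
    -- `b f - x u f² - 1` and the root is `b - 2 x u f`, whose square is `b² - 4 x u` minus `4 x u`
    -- times the quadratic; `b² - 4 x u` is the discriminant.
    root²≈discriminant : root y f * root y f ≈ discriminant y
    root²≈discriminant = begin
      root y f * root y f
        ≈⟨ solve 3 (λ x y f →
             :root x y f :* :root x y f :=
             :1 :+ 2 :· x :^ 2 :- 2 :· x :^ 2 :* y :+ x :^ 4 :- 2 :· x :^ 4 :* y
               :+ x :^ 4 :* y :^ 2 :- 4 :· x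
             :- 4 :· (x :* (:1 :+ x :* (y :- :1))) :* :quadratic x y f)
             refl x y f ⟩
      discriminant y - 4 · (x * (1# + x * (y - 1#)))
        * (f - (1# + x * (f * f) + x * x * (y - 1#) * (f * f - f)))
        ≈⟨ +-congˡ (-‿cong (trans (*-congˡ quadratic) (zeroʳ _))) ⟩
      discriminant y - 0#
        ≈⟨ solve 1 (λ a → a :- con (+ 0) := a) refl _ ⟩
      discriminant y ∎

  module _ (One-resp : ∀ {a b} → a ≈ b → One b → One a)
           (One-1+x* : ∀ a → One (1# + x * a))
           (One+One-regular : ∀ {a b} → One a → One b → IsNonZeroDivisor R (a + b))
           (x-regular : IsNonZeroDivisor R x)
    where

    -- The difference of squares factors as `(t - s) * (t + s)`, and `t + s` can be cancelled
    -- because both summands satisfy `One`.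
    squareRoot-unique : ∀ {s t} → One s → One t → t * t ≈ s * s → t ≈ s
    squareRoot-unique {s} {t} one-s one-t t²≈s² = x∙y⁻¹≈ε⇒x≈y t s
      (One+One-regular one-t one-s (t - s) (begin
        (t - s) * (t + s) ≈⟨ solve 2 (λ s t → (t :- s) :* (t :+ s) := t :* t :- s :* s) refl s t ⟩
        t * t - s * s     ≈⟨ x≈y⇒x∙y⁻¹≈ε t²≈s² ⟩
        0#                ∎))

    -- The denominator is `(u + u) * x` with `u = 1# + x * (y - 1#)`. The factor 2 is spent on
    -- writing `u + u`, a sum of two elements satisfying `One`; first `x` is cancelled, then
    -- `u + u`.
    *-denominator-cancel : ∀ {y p q} → p * denominator y ≈ q * denominator y → p ≈ q
    *-denominator-cancel {y} {p} {q} eq = x∙y⁻¹≈ε⇒x≈y p q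
      (One+One-regular one-u one-u (p - q)
        (x-regular ((p - q) * (u + u)) (begin
          (p - q) * (u + u) * x
            ≈⟨ solve 4 (λ x y p q →
                 let u = :1 :+ x :* (y :- :1) in
                 (p :- q) :* (u :+ u) :* x := p :* :denominator x y :- q :* :denominator x y)
                 refl x y p q ⟩
          p * denominator y - q * denominator y
            ≈⟨ x≈y⇒x∙y⁻¹≈ε eq ⟩
          0# ∎)))
      where
      u : Carrier
      u = 1# + x * (y - 1#)
      one-u : One u
      one-u = One-1+x* (y - 1#)

    One-root : ∀ y f → One (root y f)
    One-root y f = One-resp
      (solve 3 (λ x y f → :root x y f
         := :1 :+ x :* (x :* (y :- :1) :- 2 :· (f :* (:1 :+ x :* y :- x)))) refl x y f)
      (One-1+x* _)

toCommutativeRing : ∀ {a ℓ} {A : Set a} {_≈_ : Rel A ℓ} {_+_ _*_ : Op₂ A} { -_ : Op₁ A} 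
  {0# 1# : A} → IsCommutativeRing _≈_ _+_ _*_ -_ 0# 1# → CommutativeRing a ℓ
toCommutativeRing isCommutativeRing = record { isCommutativeRing = isCommutativeRing }

-- The operations are separate variables, so that the instance at ℤ[y]⟦x⟧ is
-- syntactically the type of theorem3p4: comparing the two types by evaluation
-- would multiply out the products of power series.
quadraticFormula :
  ∀ {a ℓ p} {A : Set a} {equal : Rel A ℓ} {add mul : Op₂ A} {neg : Op₁ A} {0# 1# : A}
  {sub : Op₂ A} {multiple : ℕ → A → A} {power : A → ℕ → A}
  (isCommutativeRing : IsCommutativeRing equal add mul neg 0# 1#) →
  let R = toCommutativeRing isCommutativeRing
      open RawSemiringDefinitions (RawRing.rawSemiring (CommutativeRing.rawRing R))
        using () renaming (_×_ to _·ᴿ_; _^_ to _^ᴿ_)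
      infix  4 _≈_
      infixl 6 _+_ _-_
      infixl 7 _*_
      infixr 8 _·_ _↑_
      _≈_ = equal; _+_ = add; _-_ = sub; _*_ = mul; _·_ = multiple; _↑_ = power
  in
  sub ≡ CommutativeRing._-_ R → multiple ≡ _·ᴿ_ → power ≡ _^ᴿ_ →
  {x y f g e h : A} (One : A → Set p) →
  (∀ {a b} → a ≈ b → One b → One a) →
  (∀ a → One (1# + x * a)) →
  (∀ {a b} → One a → One b → IsNonZeroDivisor R (a + b)) →
  IsNonZeroDivisor R x →
  h ≈ f →
  f ≈ 1# + x * (f * g) →
  g ≈ 1# + x * (e * g) →
  e ≈ g + x * (y - 1#) →
  let Δ = 1# + 2 · x ↑ 2 - 2 · x ↑ 2 * y + x ↑ 4 - 2 · x ↑ 4 * y + x ↑ 4 * y ↑ 2 - 4 · x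
      numerator = λ s → 1# - x ↑ 2 + x ↑ 2 * y - s
      denominator = 2 · x * (1# + x * y - x)
  in
  ∃[ s ] ((s * s ≈ Δ × One s) × (∀ t → t * t ≈ Δ × One t → t ≈ s))
    × (h * denominator ≈ numerator s × (∀ p → p * denominator ≈ numerator s → p ≈ h))
quadraticFormula isCommutativeRing ≡.refl ≡.refl ≡.refl {x} {y} {f} {g} {e} {h} One
  One-resp One-1+x* One+One-regular x-regular h≈f f-eq g-eq e-eq =
  -- Taking the root at `h` makes the quotient equation an identity; the functional equations are
  -- needed only to show that its square is the discriminant.
  root y h ,
  ( (root² , One-root One-resp One-1+x* One+One-regular x-regular y h)
  , λ t (t² , one-t) → squareRoot-unique One-resp One-1+x* One+One-regular x-regular
      (One-root One-resp One-1+x* One+One-regular x-regular y h) one-t (trans t² (sym root²)) ) ,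
  ( *-denominator y h
  , λ p eq → *-denominator-cancel One-resp One-1+x* One+One-regular x-regular
      (trans eq (sym (*-denominator y h))) )
  where
  open CommutativeRing (toCommutativeRing isCommutativeRing)
    using (trans; sym; +-congˡ; *-congˡ; *-congʳ)
  open QuadraticFormula (toCommutativeRing isCommutativeRing) x One
  root² = root²≈discriminant
    (trans h≈f (trans f-eq (+-congˡ (*-congˡ (*-congʳ (sym h≈f))))))
    (trans g-eq (+-congˡ (*-congˡ (*-congʳ e-eq))))

-- Weight enumerators of lists.

module Weights {c ℓ} (R : CommutativeRing c ℓ) (y : CommutativeRing.Carrier R) where
  open CommutativeRing R
  open import Algebra.Properties.Semiring.Exp semiring using (_^_; ^-homo-*)
  open import Algebra.Properties.Monoid.Sum +-monoid using (sum)
  open import Algebra.Properties.CommutativeSemigroup +-commutativeSemigroup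
    using (x∙yz≈y∙xz)
  open import Relation.Binary.Reasoning.Setoid setoid

  weight : ∀ {a} {A : Set a} → (A → ℕ) → List A → Carrier
  weight s []       = 0#
  weight s (w ∷ ws) = y ^ s w + weight s ws

  module _ {a} {A : Set a} where

    weight-cong : {s t : A → ℕ} {ws : List A} →
                  All (λ w → s w ≡ t w) ws → weight s ws ≈ weight t ws
    weight-cong []         = refl
    weight-cong (eq ∷ eqs) = +-cong (reflexive (cong (y ^_) eq)) (weight-cong eqs)

    weight-↭ : (s : A → ℕ) {vs ws : List A} → vs ↭ ws → weight s vs ≈ weight s ws
    weight-↭ s ↭.refl         = refl
    weight-↭ s (↭.prep _ p)   = +-congˡ (weight-↭ s p)
    weight-↭ s (↭.swap _ _ p) = trans (+-congˡ (+-congˡ (weight-↭ s p))) (x∙yz≈y∙xz _ _ _)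
    weight-↭ s (↭.trans p q)  = trans (weight-↭ s p) (weight-↭ s q)

    weight-++ : ∀ (s : A → ℕ) vs ws → weight s (vs ++ ws) ≈ weight s vs + weight s ws
    weight-++ s []       ws = sym (+-identityˡ _)
    weight-++ s (v ∷ vs) ws = trans (+-congˡ (weight-++ s vs ws)) (sym (+-assoc _ _ _))

    weight-concat-tabulate : ∀ (s : A → ℕ) {n} (ws : Fin n → List A) →
      weight s (concat (tabulate ws)) ≈ sum (λ i → weight s (ws i))
    weight-concat-tabulate s {zero}  ws = refl
    weight-concat-tabulate s {suc n} ws = trans
      (weight-++ s (ws Fin.zero) _)
      (+-congˡ (weight-concat-tabulate s (λ i → ws (Fin.suc i))))

  module _ {a} {A : Set a} {B C : Set a} {f : A → B → C}
           {s : A → ℕ} {t : B → ℕ} {u : C → ℕ} where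

    weight-map : ∀ {v ws} → All (λ w → u (f v w) ≡ s v ℕ.+ t w) ws →
                 weight u (map (f v) ws) ≈ y ^ s v * weight t ws
    weight-map         []                 = sym (zeroʳ _)
    weight-map {v} {w ∷ ws} (eq ∷ eqs)    = begin
      y ^ u (f v w) + weight u (map (f v) ws)
        ≈⟨ +-cong (trans (reflexive (cong (y ^_) eq)) (^-homo-* y (s v) (t w))) (weight-map eqs) ⟩
      y ^ s v * y ^ t w + y ^ s v * weight t ws
        ≈⟨ distribˡ _ _ _ ⟨
      y ^ s v * (y ^ t w + weight t ws) ∎

    -- The product rule for an additive statistic. Additivity is asked of the listed elements only,
    -- since for grafts it will be known only for avoiders.
    weight-cartesianProductWith : ∀ {vs ws} →
      All (λ v → All (λ w → u (f v w) ≡ s v ℕ.+ t w) ws) vs →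
      weight u (cartesianProductWith f vs ws) ≈ weight s vs * weight t ws
    weight-cartesianProductWith                []         = sym (zeroˡ _)
    weight-cartesianProductWith {v ∷ vs} {ws} (eqs ∷ eqss) = begin
      weight u (map (f v) ws ++ cartesianProductWith f vs ws)
        ≈⟨ weight-++ u (map (f v) ws) _ ⟩
      weight u (map (f v) ws) + weight u (cartesianProductWith f vs ws)
        ≈⟨ +-cong (weight-map eqs) (weight-cartesianProductWith eqss) ⟩
      y ^ s v * weight t ws + weight s vs * weight t ws
        ≈⟨ distribʳ _ _ _ ⟨
      (y ^ s v + weight s vs) * weight t ws ∎

-- Avoiding permutations as lists of naturals, beginning with facts about lists.

module Avoiders where
  open import Data.Bool.Base using (if_then_else_)
  open import Data.List.Membership.Propositional using (_∈_; _∉_)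
  open import Data.List.Membership.Propositional.Properties
  open import Data.List.Membership.Propositional.Properties.WithK using (unique∧set⇒bag)
  open import Data.List.Relation.Binary.BagAndSetEquality using (∼bag⇒↭)
  open import Data.List.Relation.Binary.Disjoint.Propositional using (Disjoint)
  open import Data.List.Relation.Binary.Permutation.Propositional
    using (↭⇒↭ₛ; ↭-refl; ↭-reflexive; ↭-sym; ↭-trans; ↭-prep; module PermutationReasoning)
  open import Data.List.Relation.Binary.Permutation.Propositional.Properties as ↭
    using (drop-mid; shift; ↭-length; All-resp-↭; ∈-resp-↭; ↭-map-inv; ↭-empty-inv; ↭-singleton-inv)
  import Data.List.Relation.Binary.Permutation.Setoid.Properties as PermutationSetoid
  open import Data.List.Relation.Binary.Sublist.Propositional as Sublist
    using (_⊆_; []; _∷_; _∷ʳ_; ⊆-trans; ⊆-refl; from∈; to∈)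
  import Data.List.Relation.Binary.Sublist.Propositional.Properties as Sublist
  import Data.List.Relation.Unary.All.Properties as All
  open import Data.List.Relation.Unary.AllPairs using ([]; _∷_)
  import Data.List.Relation.Unary.AllPairs.Properties as AllPairs
  open import Data.List.Relation.Unary.Any using (here; there)
  open import Data.List.Relation.Unary.Unique.Propositional using (Unique)
  import Data.List.Relation.Unary.Unique.Propositional.Properties as Unique
  open import Data.Nat.Base using (_+_)
  open import Data.Nat.Properties
  open import Data.Product.Function.NonDependent.Propositional using (_×-⇔_)
  open import Data.Sum.Base using (inj₁; inj₂)
  open import Data.Vec.Base using (Vec; []; _∷_; lookup; toList)
  import Data.Vec.Membership.DecPropositional as DecVecMembership
  import Data.Vec.Membership.Propositional.Properties as VecMembership
  import Data.Vec.Properties as Vec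
  import Data.Vec.Relation.Unary.All.Properties as VecAll
  open import Data.Vec.Relation.Unary.AllPairs using ([]; _∷_)
  import Data.Vec.Relation.Unary.Unique.Propositional as VecUnique
  import Data.Vec.Relation.Unary.Unique.Propositional.Properties as VecUnique
  open import Function.Bundles using (_⇔_; mk⇔)
  open import Relation.Nullary.Decidable using (dec-false; dec-true; does-⇔)
  open ≡ using (refl; sym; trans; setoid)

  module _ {a} {A : Set a} where

    -- Reduces the comparison of two enumerations to a membership proof in each direction.
    unique∧set⇒↭ : {xs ys : List A} → Unique xs → Unique ys →
                   (∀ {v} → v ∈ xs → v ∈ ys) → (∀ {v} → v ∈ ys → v ∈ xs) → xs ↭ ys
    unique∧set⇒↭ xs! ys! to from = ∼bag⇒↭ (unique∧set⇒bag xs! ys! (mk⇔ to from))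

    ⊆-++⁻ : ∀ {xs : List A} ys {zs} → xs ⊆ ys ++ zs →
            ∃[ us ] ∃[ vs ] xs ≡ us ++ vs × us ⊆ ys × vs ⊆ zs
    ⊆-++⁻ []       xs⊆zs = [] , _ , refl , [] , xs⊆zs
    ⊆-++⁻ (y ∷ ys) (y ∷ʳ p) =
      let us , vs , eq , p₁ , p₂ = ⊆-++⁻ ys p in us , vs , eq , y ∷ʳ p₁ , p₂
    ⊆-++⁻ (y ∷ ys) (refl ∷ p) =
      let us , vs , eq , p₁ , p₂ = ⊆-++⁻ ys p in y ∷ us , vs , cong (y ∷_) eq , refl ∷ p₁ , p₂

    ⊆-map⁻ : ∀ {b} {B : Set b} (f : B → A) ys {xs} → xs ⊆ map f ys →
             ∃[ zs ] xs ≡ map f zs × zs ⊆ ys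
    ⊆-map⁻ f []       []       = [] , refl , []
    ⊆-map⁻ f (y ∷ ys) (_ ∷ʳ p) = let zs , eq , q = ⊆-map⁻ f ys p in zs , eq , y ∷ʳ q
    ⊆-map⁻ f (y ∷ ys) (refl ∷ p) =
      let zs , eq , q = ⊆-map⁻ f ys p in y ∷ zs , cong (f y ∷_) eq , refl ∷ q

    -- Both sides are cut at the first occurrence of `v`, so the cuts agree.
    ∉-++-∷-injective : ∀ {v : A} xs xs′ {ys ys′} → v ∉ xs → v ∉ xs′ →
                       xs ++ v ∷ ys ≡ xs′ ++ v ∷ ys′ → xs ≡ xs′ × ys ≡ ys′
    ∉-++-∷-injective []       []         _ _ refl = refl , refl
    ∉-++-∷-injective []       (_ ∷ _)    _ q refl = contradiction (here refl) q
    ∉-++-∷-injective (_ ∷ _)  []         p _ refl = contradiction (here refl) p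
    ∉-++-∷-injective (x ∷ xs) (x′ ∷ xs′) p q eq with refl , eq′ ← List.∷-injective eq =
      let eq₁ , eq₂ = ∉-++-∷-injective xs xs′ (p ∘ there) (q ∘ there) eq′
      in cong (x ∷_) eq₁ , eq₂

    ++⁻-disjoint : ∀ xs {ys : List A} → Unique (xs ++ ys) → Disjoint xs ys
    ++⁻-disjoint (x ∷ xs) (x∉ ∷ _) (here refl , v∈ys) = All.lookup x∉ (∈-++⁺ʳ xs v∈ys) refl
    ++⁻-disjoint (x ∷ xs) (_ ∷ !)  (there v∈xs , v∈ys) = ++⁻-disjoint xs ! (v∈xs , v∈ys)

  map⁺-local : ∀ {a b} {A : Set a} {B : Set b} {f : A → B} {xs} →
               (∀ {x y} → x ∈ xs → y ∈ xs → f x ≡ f y → x ≡ y) →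
               Unique xs → Unique (map f xs)
  map⁺-local inj []         = []
  map⁺-local inj (x∉ ∷ xs!) =
    All.map⁺ (All.tabulate λ y∈ fx≡fy → All.lookup x∉ y∈ (inj (here refl) (there y∈) fx≡fy))
    ∷ map⁺-local (λ p q → inj (there p) (there q)) xs!

  -- Injectivity is asked on members only, because `graft` is not injective on arbitrary words.
  cartesianProductWith⁺-local :
    ∀ {a b c} {A : Set a} {B : Set b} {C : Set c} {f : A → B → C} {xs ys} →
    (∀ {w x y z} → w ∈ xs → x ∈ xs → y ∈ ys → z ∈ ys → f w y ≡ f x z → w ≡ x × y ≡ z) →
    Unique xs → Unique ys → Unique (cartesianProductWith f xs ys)
  cartesianProductWith⁺-local inj [] ys! = []
  cartesianProductWith⁺-local {f = f} {x ∷ xs} {ys} inj (x∉ ∷ xs!) ys! = Unique.++⁺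
    (map⁺-local (λ p q → proj₂ ∘ inj (here refl) (here refl) p q) ys!)
    (cartesianProductWith⁺-local (λ p q → inj (there p) (there q)) xs! ys!)
    disjoint
    where
    disjoint : Disjoint (map (f x) ys) (cartesianProductWith f xs ys)
    disjoint (p , q) with _ , z∈ , refl ← ∈-map⁻ (f x) p
                     with w , _ , w∈ , z′∈ , eq ← ∈-cartesianProductWith⁻ f xs ys q =
      All.lookup x∉ w∈ (proj₁ (inj (here refl) (there w∈) z∈ z′∈ eq))

  -- Splitting an avoider at its maximum.

  Avoids : List ℕ → Set
  Avoids w = ∀ {a b c} → a ∷ b ∷ c ∷ [] ⊆ w → ¬ (a < c × c < b)

  record Avoider (n : ℕ) (w : List ℕ) : Set where
    constructor _,_
    field
      perm   : w ↭ downFrom n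
      avoids : Avoids w

    bounded : All (_< n) w
    bounded = All-resp-↭ (↭-sym perm) (All.applyDownFrom⁺₁ id n id)

    unique : Unique w
    unique = PermutationSetoid.Unique-resp-↭ (setoid ℕ) (↭⇒↭ₛ (↭-sym perm)) (Unique.downFrom⁺ n)

    length≡ : length w ≡ n
    length≡ = trans (↭-length perm) (List.length-downFrom n)

  open Avoider public

  -- The word σ n τ with σ standardised: for τ of length `k`, the shift lifts σ above all letters of
  -- τ.
  graft : ℕ → ℕ → List ℕ → List ℕ → List ℕ
  graft n k σ τ = map (k +_) σ ++ n ∷ τ

  map-+-downFrom : ∀ k j → map (k +_) (downFrom j) ++ downFrom k ≡ downFrom (k + j)
  map-+-downFrom k zero    = cong downFrom (sym (+-identityʳ k))
  map-+-downFrom k (suc j) rewrite +-suc k j = cong (k + j ∷_) (map-+-downFrom k j)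

  Avoids-⊆ : ∀ {v w} → v ⊆ w → Avoids w → Avoids v
  Avoids-⊆ v⊆w av p = av (⊆-trans p v⊆w)

  Avoids-shift⁺ : ∀ k {w} → Avoids w → Avoids (map (k +_) w)
  Avoids-shift⁺ k {w} av p (a<c , c<b) with ⊆-map⁻ (k +_) w p
  ... | _ ∷ _ ∷ _ ∷ [] , refl , q = av q (+-cancelˡ-< k _ _ a<c , +-cancelˡ-< k _ _ c<b)

  Avoids-shift⁻ : ∀ k {w} → Avoids (map (k +_) w) → Avoids w
  Avoids-shift⁻ k av p (a<c , c<b) =
    av (Sublist.map⁺ (k +_) p) (+-monoʳ-< k a<c , +-monoʳ-< k c<b)

  -- In a forbidden triple `a`, `b`, `c`, having `a` in σ and `c` in τ would give `c < k ≤ a`, and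
  -- `n` is too large to be `a` or `c`. Hence the triple lies entirely in σ or entirely in τ.
  Avoids-graft : ∀ {n k σ τ} → All (_< n) σ → All (k ≤_) σ → All (_< n) τ → All (_< k) τ →
                 Avoids σ → Avoids τ → Avoids (σ ++ n ∷ τ)
  Avoids-graft {n} {k} {σ} {τ} σ<n k≤σ τ<n τ<k avσ avτ p (a<c , c<b) with ⊆-++⁻ σ p
  ... | []                 , _ , refl , _ , _ ∷ʳ q   = avτ q (a<c , c<b)
  ... | []                 , _ , refl , _ , refl ∷ q =
    <-asym a<c (All.lookup τ<n (Sublist.lookup q (there (here refl))))
  ... | _ ∷ []             , _ , refl , p , _ ∷ʳ q   =
    <-asym a<c (<-≤-trans (All.lookup τ<k (Sublist.lookup q (there (here refl))))
                          (All.lookup k≤σ (to∈ p)))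
  ... | _ ∷ []             , _ , refl , p , refl ∷ q   =
    <-asym a<c (<-≤-trans (All.lookup τ<k (to∈ q)) (All.lookup k≤σ (to∈ p)))
  ... | _ ∷ _ ∷ []         , _ , refl , p , _ ∷ʳ q   =
    <-asym a<c (<-≤-trans (All.lookup τ<k (to∈ q)) (All.lookup k≤σ (to∈ p)))
  ... | _ ∷ _ ∷ []         , _ , refl , p , refl ∷ q =
    <-asym c<b (All.lookup σ<n (Sublist.lookup p (there (here refl))))
  ... | _ ∷ _ ∷ _ ∷ []     , _ , refl , p , _        = avσ p (a<c , c<b)

  graft-avoider : ∀ {j k σ τ} → Avoider j σ → Avoider k τ →
                  Avoider (suc (k + j)) (graft (k + j) k σ τ)
  graft-avoider {j} {k} {σ} {τ} aσ aτ = p , Avoids-graft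
    (All.map⁺ (All.map (+-monoʳ-< k) (bounded aσ)))
    (All.map⁺ (All.universal (m≤m+n k) σ))
    (All.map (λ t<k → <-≤-trans t<k (m≤m+n k j)) (bounded aτ))
    (bounded aτ)
    (Avoids-shift⁺ k (avoids aσ))
    (avoids aτ)
    where
    open PermutationReasoning
    p : graft (k + j) k σ τ ↭ downFrom (suc (k + j))
    p = begin
      map (k +_) σ ++ k + j ∷ τ                        ↭⟨ shift (k + j) (map (k +_) σ) τ ⟩
      k + j ∷ map (k +_) σ ++ τ
        ↭⟨ ↭-prep _ (↭.++⁺ (↭.map⁺ (k +_) (perm aσ)) (perm aτ)) ⟩
      k + j ∷ map (k +_) (downFrom j) ++ downFrom k    ≡⟨ cong (k + j ∷_) (map-+-downFrom k j) ⟩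
      k + j ∷ downFrom (k + j) ∎

  Separated : ℕ → List ℕ → List ℕ → Set
  Separated n σ τ = ∃[ k ] ∃[ j ] k + j ≡ n × τ ↭ downFrom k × σ ↭ map (k +_) (downFrom j)

  -- If σ is nonempty, the largest letter lies in σ: in τ it would have to be smaller than the head
  -- of σ. Removing it from σ leaves the same situation for `n`; once σ is empty, τ holds all
  -- remaining letters.
  separated : ∀ n σ τ → σ ++ τ ↭ downFrom n → (∀ {s t} → s ∈ σ → t ∈ τ → t < s) →
              Separated n σ τ
  separated n       []      τ p τ<σ = n , 0 , +-identityʳ n , p , ↭-refl
  separated zero    (_ ∷ _) τ p τ<σ with () ← ↭-empty-inv p
  separated (suc n) (s ∷ σ) τ p τ<σ with ∈-++⁻ (s ∷ σ) (∈-resp-↭ (↭-sym p) (here refl))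
  ... | inj₂ n∈τ = contradiction (τ<σ (here refl) n∈τ)
    (≤⇒≯ (s≤s⁻¹ (All.lookup (All.applyDownFrom⁺₁ id (suc n) id) (∈-resp-↭ p (here refl)))))
  ... | inj₁ n∈σ = peel n∈σ p τ<σ
    where
    peel : ∀ {σ} → n ∈ σ → σ ++ τ ↭ downFrom (suc n) →
           (∀ {s t} → s ∈ σ → t ∈ τ → t < s) → Separated (suc n) σ τ
    peel n∈σ p τ<σ with σ₁ , σ₂ , refl ← ∈-∃++ n∈σ =
      insert (separated n (σ₁ ++ σ₂) τ p′ (τ<σ ∘ ⊆n))
      where
      open PermutationReasoning
      p′ : (σ₁ ++ σ₂) ++ τ ↭ downFrom n
      p′ = begin
        (σ₁ ++ σ₂) ++ τ    ≡⟨ List.++-assoc σ₁ σ₂ τ ⟩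
        σ₁ ++ σ₂ ++ τ      ↭⟨ drop-mid σ₁ []
          (↭-trans (↭-reflexive (sym (List.++-assoc σ₁ (n ∷ σ₂) τ))) p) ⟩
        downFrom n         ∎
      ⊆n : ∀ {s} → s ∈ σ₁ ++ σ₂ → s ∈ σ₁ ++ n ∷ σ₂
      ⊆n s∈ = ∈-resp-↭ (↭-sym (shift n σ₁ σ₂)) (there s∈)
      insert : Separated n (σ₁ ++ σ₂) τ → Separated (suc n) (σ₁ ++ n ∷ σ₂) τ
      insert (k , j , refl , pτ , pσ) = k , suc j , +-suc k j , pτ ,
        ↭-trans (shift n σ₁ σ₂) (↭-prep _ pσ)

  graft⁻¹ : ∀ {n w} → Avoider (suc n) w →
            ∃[ k ] ∃[ j ] ∃[ σ ] ∃[ τ ]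
              k + j ≡ n × Avoider j σ × Avoider k τ × w ≡ graft n k σ τ
  graft⁻¹ {n} {w} aw = split (∈-resp-↭ (↭-sym (perm aw)) (here refl)) aw
    where
    split : ∀ {w} → n ∈ w → Avoider (suc n) w →
            ∃[ k ] ∃[ j ] ∃[ σ ] ∃[ τ ]
              k + j ≡ n × Avoider j σ × Avoider k τ × w ≡ graft n k σ τ
    split n∈w (pw , av) with σ′ , τ , refl ← ∈-∃++ n∈w = rebuild (separated n σ′ τ p τ<σ′)
      where
      p : σ′ ++ τ ↭ downFrom n
      p = drop-mid σ′ [] pw

      p! : Unique (σ′ ++ τ)
      p! = PermutationSetoid.Unique-resp-↭ (setoid ℕ) (↭⇒↭ₛ (↭-sym p)) (Unique.downFrom⁺ n)

      τ<n : ∀ {t} → t ∈ τ → t < n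
      τ<n t∈τ = All.lookup (All.applyDownFrom⁺₁ id n id) (∈-resp-↭ p (∈-++⁺ʳ σ′ t∈τ))

      τ<σ′ : ∀ {s t} → s ∈ σ′ → t ∈ τ → t < s
      -- With `s < t` the letters `s`, `n`, `t` would form a 1-3-2; `t ≡ s` would repeat a letter.
      τ<σ′ {s} {t} s∈σ′ t∈τ = ≤∧≢⇒<
        (≮⇒≥ λ s<t → av (Sublist.++⁺ (from∈ s∈σ′) (refl ∷ from∈ t∈τ)) (s<t , τ<n t∈τ))
        (λ t≡s → ++⁻-disjoint σ′ p! (s∈σ′ , subst (_∈ τ) t≡s t∈τ))

      rebuild : Separated n σ′ τ → _
      -- A rearrangement of a shifted list is the shift of a rearrangement; this standardises σ′.
      rebuild (k , j , k+j≡n , pτ , pσ′) with σ , refl , pσ ← ↭-map-inv (k +_) (↭-sym pσ′) =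
        k , j , σ , τ , k+j≡n ,
        (↭-sym pσ , Avoids-shift⁻ k (Avoids-⊆ (Sublist.++⁺ʳ _ ⊆-refl) av)) ,
        (pτ , Avoids-⊆ (Sublist.++⁺ˡ _ (n ∷ʳ ⊆-refl)) av) ,
        refl

  max∉shift : ∀ {j k σ} → Avoider j σ → k + j ∉ map (k +_) σ
  max∉shift {j} {k} aσ p with _ , s∈σ , eq ← ∈-map⁻ (k +_) p =
    <⇒≢ (All.lookup (bounded aσ) s∈σ) (sym (+-cancelˡ-≡ k _ _ eq))

  -- The maximum is absent from both shifted left parts, so it marks the cut. Then τ ≡ τ′ determines
  -- `k` as its length, and the shift can be undone. The lengths may differ beforehand, so the lemma
  -- also separates grafts of different sizes.
  graft-injective : ∀ {j j′ k k′ σ σ′ τ τ′} →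
    Avoider j σ → Avoider j′ σ′ → Avoider k τ → Avoider k′ τ′ → k + j ≡ k′ + j′ →
    graft (k + j) k σ τ ≡ graft (k′ + j′) k′ σ′ τ′ → σ ≡ σ′ × τ ≡ τ′
  graft-injective {j} {j′} {k} {k′} {σ} {σ′} {τ} {τ′} aσ aσ′ aτ aτ′ k+j≡k′+j′ eq
    with eq₁ , refl ← ∉-++-∷-injective (map (k +_) σ) (map (k′ +_) σ′)
                        (max∉shift aσ)
                        (subst (_∉ map (k′ +_) σ′) (sym k+j≡k′+j′) (max∉shift aσ′))
                        (trans eq (cong (λ n → graft n k′ σ′ τ′) (sym k+j≡k′+j′)))
    with refl ← trans (sym (length≡ aτ)) (length≡ aτ′) =
    List.map-injective (+-cancelˡ-≡ k _ _) eq₁ , refl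

  -- Occurrences and initial ascents of a graft.

  indicator : ∀ {p} {P : Set p} → Dec P → ℕ
  indicator P? = if does P? then 1 else 0

  indicator-yes : ∀ {p} {P : Set p} (P? : Dec P) → P → indicator P? ≡ 1
  indicator-yes P? p = cong (if_then 1 else 0) (dec-true P? p)

  indicator-no : ∀ {p} {P : Set p} (P? : Dec P) → ¬ P → indicator P? ≡ 0
  indicator-no P? ¬p = cong (if_then 1 else 0) (dec-false P? ¬p)

  indicator-⇔ : ∀ {p q} {P : Set p} {Q : Set q} (P? : Dec P) (Q? : Dec Q) → P ⇔ Q →
                indicator P? ≡ indicator Q?
  indicator-⇔ P? Q? P⇔Q = cong (if_then 1 else 0) (does-⇔ P⇔Q P? Q?)

  occurrences : List ℕ → ℕ
  occurrences (a ∷ w@(b ∷ c ∷ _)) = indicator (b <? c ×-dec c <? a) + occurrences w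
  occurrences _ = 0

  ascent : List ℕ → ℕ
  ascent (b ∷ c ∷ _) = indicator (b <? c)
  ascent _ = 0

  -- The ascent at the beginning of w n τ, where n exceeds all letters of w and τ.
  ascent′ : List ℕ → ℕ
  ascent′ (_ ∷ []) = 1
  ascent′ w        = ascent w

  <-shift : ∀ k {m n} → (k + m < k + n) ⇔ (m < n)
  <-shift k = mk⇔ (+-cancelˡ-< k _ _) (+-monoʳ-< k)

  occurrences-shift : ∀ k w → occurrences (map (k +_) w) ≡ occurrences w
  occurrences-shift k []       = refl
  occurrences-shift k (_ ∷ []) = refl
  occurrences-shift k (_ ∷ _ ∷ []) = refl
  occurrences-shift k (a ∷ w@(b ∷ c ∷ _)) = cong₂ _+_
    (indicator-⇔ (k + b <? k + c ×-dec k + c <? k + a) (b <? c ×-dec c <? a)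
      (<-shift k ×-⇔ <-shift k))
    (occurrences-shift k w)

  ascent′-shift : ∀ k w → ascent′ (map (k +_) w) ≡ ascent′ w
  ascent′-shift k []          = refl
  ascent′-shift k (_ ∷ [])    = refl
  ascent′-shift k (b ∷ c ∷ _) = indicator-⇔ (k + b <? k + c) (b <? c) (<-shift k)

  -- The window `n`, `b`, `c` is an occurrence exactly when `b < c`, as `c < n` holds anyway.
  occurrences-max : ∀ {n τ} → All (_< n) τ → occurrences (n ∷ τ) ≡ occurrences τ + ascent τ
  occurrences-max []       = refl
  occurrences-max (_ ∷ []) = refl
  occurrences-max {n} {b ∷ c ∷ τ} (_ ∷ c<n ∷ _) = trans
    (cong (_+ occurrences (b ∷ c ∷ τ))
      (indicator-⇔ (b <? c ×-dec c <? n) (b <? c) (mk⇔ proj₁ (_, c<n))))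
    (+-comm (indicator (b <? c)) _)

  -- A window with `n` in second or third place is no occurrence, since `n` exceeds its neighbours.
  -- Besides windows inside σ or τ only the one starting at `n` can count.
  occurrences-++-max : ∀ {n σ τ} → All (_< n) σ → All (_< n) τ →
    occurrences (σ ++ n ∷ τ) ≡ occurrences σ + (occurrences τ + ascent τ)
  occurrences-++-max [] τ<n = occurrences-max τ<n
  occurrences-++-max (_ ∷ []) [] = refl
  occurrences-++-max {n} {a ∷ []} {τ@(c ∷ _)} (_ ∷ []) τ<n@(c<n ∷ _) = trans
    (cong (_+ occurrences (n ∷ τ)) (indicator-no (n <? c ×-dec c <? a) (<-asym c<n ∘ proj₁)))
    (occurrences-max τ<n)
  occurrences-++-max {n} {a ∷ b ∷ []} {τ} (a<n ∷ σ<n) τ<n = trans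
    (cong (_+ occurrences (b ∷ n ∷ τ)) (indicator-no (b <? n ×-dec n <? a) (<-asym a<n ∘ proj₂)))
    (occurrences-++-max σ<n τ<n)
  occurrences-++-max {n} {a ∷ σ@(b ∷ c ∷ _)} (_ ∷ σ<n) τ<n = trans
    (cong (indicator (b <? c ×-dec c <? a) +_) (occurrences-++-max σ<n τ<n))
    (sym (+-assoc (indicator (b <? c ×-dec c <? a)) (occurrences σ) _))

  ascent-++-max : ∀ {n σ τ} → All (_< n) σ → All (_< n) τ → ascent (σ ++ n ∷ τ) ≡ ascent′ σ
  ascent-++-max               []         []        = refl
  ascent-++-max {n} {τ = c ∷ _} []       (c<n ∷ _) = indicator-no (n <? c) (<-asym c<n)
  ascent-++-max {n} {a ∷ []}  (a<n ∷ []) _         = indicator-yes (a <? n) a<n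
  ascent-++-max               (_ ∷ _ ∷ _) _        = refl

  module _ {j k σ τ} (aσ : Avoider j σ) (aτ : Avoider k τ) where
    private
      σ′<max : All (_< k + j) (map (k +_) σ)
      σ′<max = All.map⁺ (All.map (+-monoʳ-< k) (bounded aσ))
      τ<max : All (_< k + j) τ
      τ<max = All.map (λ t<k → <-≤-trans t<k (m≤m+n k j)) (bounded aτ)

    occurrences-graft :
      occurrences (graft (k + j) k σ τ) ≡ occurrences σ + (occurrences τ + ascent τ)
    occurrences-graft = trans
      (occurrences-++-max σ′<max τ<max)
      (cong (_+ _) (occurrences-shift k σ))

    ascent-graft : ascent (graft (k + j) k σ τ) ≡ ascent′ σ
    ascent-graft = trans (ascent-++-max σ′<max τ<max) (ascent′-shift k σ)

  occurrences+ascent occurrences+ascent′ : List ℕ → ℕ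
  occurrences+ascent  w = occurrences w + ascent w
  occurrences+ascent′ w = occurrences w + ascent′ w

  -- Words over `Fin n` as lists of naturals.

  letters : ∀ {n m} → Vec (Fin n) m → List ℕ
  letters v = map toℕ (toList v)

  letters-injective : ∀ {n m} {v w : Vec (Fin n) m} → letters v ≡ letters w → v ≡ w
  letters-injective {v = []}    {[]}    _  = refl
  letters-injective {v = i ∷ v} {j ∷ w} eq =
    let i≡j , eq′ = List.∷-injective eq in cong₂ _∷_ (Fin.toℕ-injective i≡j) (letters-injective eq′)

  letters-bounded : ∀ {n m} (v : Vec (Fin n) m) → All (_< n) (letters v)
  letters-bounded v = All.map⁺ (All.universal Fin.toℕ<n (toList v))

  letters-surjective : ∀ {n m w} → All (_< n) w → length w ≡ m → ∃[ v ] letters {n} {m} v ≡ w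
  letters-surjective []          refl = [] , refl
  letters-surjective (i<n ∷ w<n) refl =
    let v , eq = letters-surjective w<n refl in
    fromℕ< i<n ∷ v , cong₂ _∷_ (Fin.toℕ-fromℕ< i<n) eq

  letters-unique⁺ : ∀ {n m} {v : Vec (Fin n) m} → VecUnique.Unique v → Unique (letters v)
  letters-unique⁺ []        = []
  letters-unique⁺ (i∉ ∷ v!) =
    All.map⁺ (All.map (_∘ Fin.toℕ-injective) (VecAll.toList⁺ i∉)) ∷ letters-unique⁺ v!

  letters-unique⁻ : ∀ {n m} (v : Vec (Fin n) m) → Unique (letters v) → VecUnique.Unique v
  letters-unique⁻ []      []        = []
  letters-unique⁻ (i ∷ v) (i∉ ∷ v!) =
    VecAll.toList⁻ (All.map (_∘ cong toℕ) (All.map⁻ i∉)) ∷ letters-unique⁻ v v!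

  -- Distinct letters exhaust `Fin n`: a missing `i` put in front of `π` would give `suc n` distinct
  -- letters, against the pigeonhole principle.
  letters-↭ : ∀ {n} (π : Word n) → IsPermutation π → letters π ↭ downFrom n
  letters-↭ {n} π π! = unique∧set⇒↭ (letters-unique⁺ π!) (Unique.downFrom⁺ n)
    (∈-downFrom⁺ ∘ All.lookup (letters-bounded π))
    (λ i∈ → let i<n = ∈-downFrom⁻ i∈ in
      subst (_∈ letters π) (Fin.toℕ-fromℕ< i<n)
        (∈-map⁺ toℕ (VecMembership.∈-toList⁺ (onto (fromℕ< i<n)))))
    where
    open DecVecMembership Fin._≟_ using (_∈?_) renaming (_∈_ to _∈ᵥ_)
    onto : ∀ i → i ∈ᵥ π
    onto i with i ∈? π
    ... | yes i∈π = i∈π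
    ... | no  i∉π =
      let j , k , j<k , eq = Fin.pigeonhole (ℕ.n<1+n n) (lookup (i ∷ π))
          i∉π′ = VecAll.toList⁻ (All.¬Any⇒All¬ _ (i∉π ∘ VecMembership.∈-toList⁻))
      in contradiction (VecUnique.lookup-injective (i∉π′ ∷ π!) j k eq) (Fin.<⇒≢ j<k)

  single-⊆⁺ : ∀ {n m} (v : Vec (Fin n) m) c → toℕ (lookup v c) ∷ [] ⊆ letters v
  single-⊆⁺ v c = from∈ (∈-map⁺ toℕ (VecMembership.∈-toList⁺ (VecMembership.∈-lookup c v)))

  pair-⊆⁺ : ∀ {n m} (v : Vec (Fin n) m) {b c} → b Fin.< c →
            toℕ (lookup v b) ∷ toℕ (lookup v c) ∷ [] ⊆ letters v
  pair-⊆⁺ (i ∷ v) {zero}  {suc c} _   = refl ∷ single-⊆⁺ v c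
  pair-⊆⁺ (i ∷ v) {suc b} {suc c} b<c = toℕ i ∷ʳ pair-⊆⁺ v (s≤s⁻¹ b<c)

  -- Increasing position triples become sublists of length three; lengths one and two are the stages
  -- reached once leading positions are consumed.
  triple-⊆⁺ : ∀ {n m} (v : Vec (Fin n) m) {a b c} → a Fin.< b → b Fin.< c →
              toℕ (lookup v a) ∷ toℕ (lookup v b) ∷ toℕ (lookup v c) ∷ [] ⊆ letters v
  triple-⊆⁺ (i ∷ v) {zero}  {suc b} {suc c} _   b<c = refl ∷ pair-⊆⁺ v (s≤s⁻¹ b<c)
  triple-⊆⁺ (i ∷ v) {suc a} {suc b} {suc c} a<b b<c =
    toℕ i ∷ʳ triple-⊆⁺ v (s≤s⁻¹ a<b) (s≤s⁻¹ b<c)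

  single-⊆⁻ : ∀ {n m} (v : Vec (Fin n) m) {z} → z ∷ [] ⊆ letters v → ∃[ c ] z ≡ toℕ (lookup v c)
  single-⊆⁻ (i ∷ v) (refl ∷ p) = zero , refl
  single-⊆⁻ (i ∷ v) (_ ∷ʳ p)   = let c , eq = single-⊆⁻ v p in suc c , eq

  pair-⊆⁻ : ∀ {n m} (v : Vec (Fin n) m) {y z} → y ∷ z ∷ [] ⊆ letters v →
            ∃[ b ] ∃[ c ] b Fin.< c × y ≡ toℕ (lookup v b) × z ≡ toℕ (lookup v c)
  pair-⊆⁻ (i ∷ v) (refl ∷ p) =
    let c , eq = single-⊆⁻ v p in zero , suc c , s≤s z≤n , refl , eq
  pair-⊆⁻ (i ∷ v) (_ ∷ʳ p)   =
    let b , c , b<c , eqs = pair-⊆⁻ v p in suc b , suc c , s≤s b<c , eqs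

  triple-⊆⁻ : ∀ {n m} (v : Vec (Fin n) m) {x y z} → x ∷ y ∷ z ∷ [] ⊆ letters v →
              ∃[ a ] ∃[ b ] ∃[ c ] a Fin.< b × b Fin.< c ×
                x ≡ toℕ (lookup v a) × y ≡ toℕ (lookup v b) × z ≡ toℕ (lookup v c)
  triple-⊆⁻ (i ∷ v) (refl ∷ p) =
    let b , c , b<c , eqs = pair-⊆⁻ v p in zero , suc b , suc c , s≤s z≤n , s≤s b<c , refl , eqs
  triple-⊆⁻ (i ∷ v) (_ ∷ʳ p)   =
    let a , b , c , a<b , b<c , eqs = triple-⊆⁻ v p
    in suc a , suc b , suc c , s≤s a<b , s≤s b<c , eqs

  letters-avoids⁺ : ∀ {n} (π : Word n) → Avoids-1-3-2 π → Avoids (letters π)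
  letters-avoids⁺ π av p (x<z , z<y)
    with a , b , c , a<b , b<c , refl , refl , refl ← triple-⊆⁻ π p =
    av (a , b , c , a<b , b<c , x<z , z<y)

  letters-avoids⁻ : ∀ {n} (π : Word n) → Avoids (letters π) → Avoids-1-3-2 π
  letters-avoids⁻ π av (a , b , c , a<b , b<c , x<z , z<y) = av (triple-⊆⁺ π a<b b<c) (x<z , z<y)

  occurrences-letters : ∀ {n m} (v : Vec (Fin n) m) → occurrences (letters v) ≡ occ₃₁₂ v
  occurrences-letters []              = refl
  occurrences-letters (_ ∷ [])        = refl
  occurrences-letters (_ ∷ _ ∷ [])    = refl
  occurrences-letters (a ∷ w@(b ∷ c ∷ _)) =
    -- Comparison in `Fin` is comparison of the `toℕ` values, so the indicators agree
    -- definitionally.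
    cong (indicator (b Fin.<? c ×-dec c Fin.<? a) +_) (occurrences-letters w)

  allVecs! : ∀ n m → Unique (allVecs n m)
  allVecs! n zero    = [] ∷ []
  allVecs! n (suc m) =
    Unique.cartesianProductWith⁺ _∷_ Vec.∷-injective (Unique.allFin⁺ n) (allVecs! n m)

  ∈-allVecs : ∀ {n m} (v : Vec (Fin n) m) → v ∈ allVecs n m
  ∈-allVecs []      = here refl
  ∈-allVecs (i ∷ v) = ∈-cartesianProductWith⁺ _∷_ (∈-allFin i) (∈-allVecs v)

  -- Enumerating the avoiders recursively.

  -- With the word's own number of occurrences, the last condition of `Counted` holds by `refl`;
  -- what remains is being a 1-3-2-avoiding permutation.
  Admissible : ∀ {n} → Word n → Set
  Admissible π = Counted (occ₃₁₂ π) π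

  admissible? : ∀ {n} (π : Word n) → Dec (Admissible π)
  admissible? π = counted? (occ₃₁₂ π) π

  -- Opaque, because conversion checking would otherwise run the enumeration.
  opaque
    avoiders : ℕ → List (List ℕ)
    avoiders n = map letters (List.filter admissible? (allVecs n n))

    avoiders! : ∀ n → Unique (avoiders n)
    avoiders! n = Unique.map⁺ letters-injective (Unique.filter⁺ admissible? (allVecs! n n))

    avoiders-sound : ∀ {n w} → w ∈ avoiders n → Avoider n w
    avoiders-sound {n} w∈
      with π , π∈ , refl ← ∈-map⁻ letters w∈
      with _ , π! , av , _ ← ∈-filter⁻ admissible? {xs = allVecs n n} π∈ =
      letters-↭ π π! , letters-avoids⁺ π av

    avoiders-complete : ∀ {n w} → Avoider n w → w ∈ avoiders n
    avoiders-complete {n} aw with π , refl ← letters-surjective (bounded aw) (length≡ aw) =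
      ∈-map⁺ letters (∈-filter⁺ admissible? (∈-allVecs π)
        (letters-unique⁻ π (unique aw) , letters-avoids⁻ π (avoids aw) , refl))

  -- `toℕ i` is the length of σ and `n ∸ toℕ i` that of τ. This is the indexing of `cauchyProduct`,
  -- so summing products of weights over `i` gives a coefficient of a product by definition.
  grafts : ∀ n → Fin (suc n) → List (List ℕ)
  grafts n i = cartesianProductWith (graft n (n ∸ toℕ i)) (avoiders (toℕ i)) (avoiders (n ∸ toℕ i))

  n∸i+i≡n : ∀ {n} (i : Fin (suc n)) → n ∸ toℕ i + toℕ i ≡ n
  n∸i+i≡n i = m∸n+n≡m (Fin.toℕ≤pred[n] i)

  ∈-grafts⁻ : ∀ {n} (i : Fin (suc n)) {w} → w ∈ grafts n i → ∃[ σ ] ∃[ τ ]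
    Avoider (toℕ i) σ × Avoider (n ∸ toℕ i) τ × w ≡ graft (n ∸ toℕ i + toℕ i) (n ∸ toℕ i) σ τ
  ∈-grafts⁻ {n} i w∈ =
    let σ , τ , σ∈ , τ∈ , eq = ∈-cartesianProductWith⁻ (graft n (n ∸ toℕ i)) (avoiders (toℕ i)) _ w∈
    in σ , τ , avoiders-sound σ∈ , avoiders-sound τ∈ ,
       trans eq (cong (λ m → graft m (n ∸ toℕ i) σ τ) (sym (n∸i+i≡n i)))

  grafts! : ∀ {n} (i : Fin (suc n)) → Unique (grafts n i)
  grafts! {n} i = cartesianProductWith⁺-local
    (λ σ∈ σ′∈ τ∈ τ′∈ eq → graft-injective
      (avoiders-sound σ∈) (avoiders-sound σ′∈) (avoiders-sound τ∈) (avoiders-sound τ′∈) refl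
      (subst (λ m → graft m (n ∸ toℕ i) _ _ ≡ graft m (n ∸ toℕ i) _ _) (sym (n∸i+i≡n i)) eq))
    (avoiders! (toℕ i)) (avoiders! (n ∸ toℕ i))

  grafts-disjoint : ∀ {n} {i i′ : Fin (suc n)} → i ≢ i′ → Disjoint (grafts n i) (grafts n i′)
  grafts-disjoint {n} {i} {i′} i≢i′ (w∈ , w∈′)
    with σ , τ , aσ , aτ , refl ← ∈-grafts⁻ i w∈
    with σ′ , τ′ , aσ′ , aτ′ , eq ← ∈-grafts⁻ i′ w∈′
    with refl , _ ← graft-injective aσ aσ′ aτ aτ′ (trans (n∸i+i≡n i) (sym (n∸i+i≡n i′))) eq =
    i≢i′ (Fin.toℕ-injective (trans (sym (length≡ aσ)) (length≡ aσ′)))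

  ∈-grafts⁺ : ∀ {n w} → Avoider (suc n) w → ∃[ i ] w ∈ grafts n i
  ∈-grafts⁺ aw with k , j , σ , τ , refl , aσ , aτ , refl ← graft⁻¹ aw =
    fromℕ< j<1+n , lemma (sym (Fin.toℕ-fromℕ< j<1+n))
    where
    j<1+n : j < suc (k + j)
    j<1+n = s≤s (m≤n+m j k)
    -- The value `toℕ (fromℕ< j<1+n)` is abstracted to `i`, so that matching on `refl` replaces it
    -- by `j`.
    lemma : ∀ {i} → j ≡ i → graft (k + j) k σ τ ∈
      cartesianProductWith (graft (k + j) (k + j ∸ i)) (avoiders i) (avoiders (k + j ∸ i))
    lemma refl rewrite m+n∸n≡m k j =
      ∈-cartesianProductWith⁺ (graft (k + j) k) (avoiders-complete aσ) (avoiders-complete aτ)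

  -- Both lists are free of duplicates and contain exactly the avoiders of length `suc n`:
  -- membership passes one way by `graft⁻¹` and back by `graft-avoider`.
  avoiders-suc : ∀ n → avoiders (suc n) ↭ concat (tabulate (grafts n))
  avoiders-suc n = unique∧set⇒↭ (avoiders! (suc n))
    (Unique.concat⁺ (All.tabulate⁺ grafts!) (AllPairs.tabulate⁺ grafts-disjoint))
    (λ w∈ → let i , w∈i = ∈-grafts⁺ (avoiders-sound w∈)
            in ∈-concat⁺′ w∈i (∈-tabulate⁺ {f = grafts n} i))
    from
    where
    from : ∀ {w} → w ∈ concat (tabulate (grafts n)) → w ∈ avoiders (suc n)
    from w∈ with _ , w∈ws , ws∈ ← ∈-concat⁻′ (tabulate (grafts n)) w∈
            with i , refl ← ∈-tabulate⁻ {f = grafts n} ws∈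
            with σ , τ , aσ , aτ , refl ← ∈-grafts⁻ i w∈ws =
      avoiders-complete (subst
        (λ m → Avoider (suc m) (graft (n ∸ toℕ i + toℕ i) (n ∸ toℕ i) σ τ))
        (n∸i+i≡n i) (graft-avoider aσ aτ))

  avoiders-0 : avoiders 0 ↭ [ [] ]
  avoiders-0 = unique∧set⇒↭ (avoiders! 0) ([] ∷ [])
    (here ∘ ↭-empty-inv ∘ perm ∘ avoiders-sound)
    (λ { (here refl) → avoiders-complete (↭-refl , λ ()) })

  avoiders-1 : avoiders 1 ↭ [ [ 0 ] ]
  avoiders-1 = unique∧set⇒↭ (avoiders! 1) ([] ∷ [])
    (here ∘ ↭-singleton-inv ∘ perm ∘ avoiders-sound)
    (λ { (here refl) → avoiders-complete (↭-refl , λ { (_ ∷ʳ ()) ; (_ ∷ ()) }) })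

-- Functional equations of the generating functions.

module GeneratingFunctions {c ℓ} (R : CommutativeRing c ℓ) (y₀ : CommutativeRing.Carrier R) where
  private
    module R = CommutativeRing R
  open Avoiders
  open Weights R y₀
  open SeriesRing R
  open PowerSeries R.rawRing using (Series; constant) renaming (indeterminate to x)
  open CommutativeRing commutativeRing
  open import Algebra.Properties.Monoid.Sum R.+-monoid using (sum-cong-≋)

  y : Series
  y = constant y₀

  generating : (List ℕ → ℕ) → Series
  generating s n = weight s (avoiders n)

  -- The empty word gives the constant term; in positive degree, splitting at the maximum turns
  -- additivity over `graft` into a product, and the removed maximum accounts for the factor `x`.
  generating-graft : ∀ s s₁ s₂ → s [] ≡ 0 →
    (∀ {j k σ τ} → Avoider j σ → Avoider k τ →
      s (graft (k ℕ.+ j) k σ τ) ≡ s₁ σ ℕ.+ s₂ τ) →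
    generating s ≈ 1# + x * (generating s₁ * generating s₂)
  generating-graft s s₁ s₂ s[]≡0 s-graft zero = begin
    weight s (avoiders 0)        ≈⟨ weight-↭ s avoiders-0 ⟩
    weight s [ [] ]              ≈⟨ weight-cong {s = s} {t = λ _ → 0} (s[]≡0 ∷ []) ⟩
    R.1# R.+ R.0#                ≈⟨ R.+-congˡ (indeterminate-⊛₀ (generating s₁ * generating s₂)) ⟨
    R.1# R.+ (x * (generating s₁ * generating s₂)) 0 ∎
    where open import Relation.Binary.Reasoning.Setoid R.setoid
  generating-graft s s₁ s₂ s[]≡0 s-graft (suc n) = begin
    weight s (avoiders (suc n))
      ≈⟨ weight-↭ s (avoiders-suc n) ⟩
    weight s (concat (tabulate (grafts n)))
      ≈⟨ weight-concat-tabulate s (grafts n) ⟩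
    sum (λ i → weight s (grafts n i))
      ≈⟨ sum-cong-≋ {suc n} (λ i → weight-cartesianProductWith {s = s₁} {s₂} {s} (additive i)) ⟩
    (generating s₁ * generating s₂) n
      ≈⟨ tail-indeterminate-⊛ (generating s₁ * generating s₂) n ⟨
    (x * (generating s₁ * generating s₂)) (suc n)
      ≈⟨ R.+-identityˡ _ ⟨
    R.0# R.+ (x * (generating s₁ * generating s₂)) (suc n) ∎
    where
    open import Relation.Binary.Reasoning.Setoid R.setoid
    open import Algebra.Definitions.RawMonoid R.+-rawMonoid using (sum)
    additive : ∀ i → All (λ σ → All (λ τ → s (graft n (n ∸ toℕ i) σ τ) ≡ s₁ σ ℕ.+ s₂ τ)
                                    (avoiders (n ∸ toℕ i)))
                         (avoiders (toℕ i))
    additive i = All.tabulate λ {σ} σ∈ → All.tabulate λ {τ} τ∈ →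
      subst (λ m → s (graft m (n ∸ toℕ i) σ τ) ≡ s₁ σ ℕ.+ s₂ τ) (n∸i+i≡n i)
        (s-graft (avoiders-sound σ∈) (avoiders-sound τ∈))

  -- `f` and `g` are F and G; `e` is the factor contributed by σ in the equation for G, where a
  -- single letter followed by the maximum also forms an ascent.
  f g e : Series
  f = generating occurrences
  g = generating occurrences+ascent
  e = generating occurrences+ascent′

  f-equation : f ≈ 1# + x * (f * g)
  f-equation = generating-graft occurrences occurrences occurrences+ascent ≡.refl occurrences-graft

  -- `ascent′` and `ascent` differ only on words of length one. So the series differ only in degree
  -- 1, where the single avoider weighs `y₀` instead of 1.
  e-equation : e ≈ g + x * (y - 1#)
  e-equation zero          = begin
    e 0                                    ≈⟨ weight-↭ occurrences+ascent′ avoiders-0 ⟩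
    weight occurrences+ascent′ [ [] ]      ≈⟨ weight-↭ occurrences+ascent avoiders-0 ⟨
    g 0                                    ≈⟨ R.+-identityʳ _ ⟨
    g 0 R.+ R.0#                           ≈⟨ R.+-congˡ (indeterminate-⊛₀ (y - 1#)) ⟨
    g 0 R.+ (x * (y - 1#)) 0               ∎
    where
    open import Relation.Binary.Reasoning.Setoid R.setoid
  e-equation (suc zero)    = begin
    e 1                                    ≈⟨ weight-↭ occurrences+ascent′ avoiders-1 ⟩
    y₀ R.* R.1# R.+ R.0#
      ≈⟨ solve 1 (λ a → a :* con (+ 1) :+ con (+ 0) := con (+ 1) :+ con (+ 0) :+ (a :- con (+ 1)))
           R.refl y₀ ⟩
    R.1# R.+ R.0# R.+ (y₀ R.- R.1#)        ≈⟨ R.+-cong (weight-↭ occurrences+ascent avoiders-1)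
                                                (tail-indeterminate-⊛ (y - 1#) 0) ⟨
    g 1 R.+ (x * (y - 1#)) 1               ∎
    where
    open import Relation.Binary.Reasoning.Setoid R.setoid
    open IntegerCoefficients R
    open import Data.Integer.Base using (+_)
  e-equation (suc (suc n)) = begin
    e (suc (suc n))
      ≈⟨ weight-cong (All.tabulate λ {w} w∈ →
           cong (occurrences w ℕ.+_) (ascent′≡ascent w (length≡ (avoiders-sound w∈)))) ⟩
    g (suc (suc n))                        ≈⟨ R.+-identityʳ _ ⟨
    g (suc (suc n)) R.+ R.0#               ≈⟨ R.+-congˡ (R.-‿inverseʳ _) ⟨
    g (suc (suc n)) R.+ (R.0# R.- R.0#)    ≈⟨ R.+-congˡ (tail-indeterminate-⊛ (y - 1#) (suc n)) ⟨
    g (suc (suc n)) R.+ (x * (y - 1#)) (suc (suc n)) ∎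
    where
    open import Relation.Binary.Reasoning.Setoid R.setoid
    ascent′≡ascent : ∀ w → length w ≡ suc (suc n) → ascent′ w ≡ ascent w
    ascent′≡ascent (_ ∷ _ ∷ _) _ = ≡.refl

  -- The initial ascent of a graft is decided by σ, so it joins the occurrences in σ to give the
  -- statistic of `e`. The ascent of τ accounts for the occurrence starting at the maximum.
  g-equation : g ≈ 1# + x * (e * g)
  g-equation =
    generating-graft occurrences+ascent occurrences+ascent′ occurrences+ascent ≡.refl additive
    where
    additive : ∀ {j k σ τ} → Avoider j σ → Avoider k τ →
      occurrences (graft (k ℕ.+ j) k σ τ) ℕ.+ ascent (graft (k ℕ.+ j) k σ τ)
        ≡ (occurrences σ ℕ.+ ascent′ σ) ℕ.+ (occurrences τ ℕ.+ ascent τ)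
    additive {σ = σ} {τ} aσ aτ = ≡.trans
      (cong₂ ℕ._+_ (occurrences-graft aσ aτ) (ascent-graft aσ aτ))
      (ℕ-solve 3 (λ o t a → o ℕ:+ t ℕ:+ a ℕ:= o ℕ:+ a ℕ:+ t) ≡.refl
        (occurrences σ) (occurrences τ ℕ.+ ascent τ) (ascent′ σ))
      where open import Data.Nat.Solver using (module +-*-Solver)
            open +-*-Solver renaming (solve to ℕ-solve; _:+_ to _ℕ:+_; _:=_ to _ℕ:=_)

-- Specialisation to `ℤ[y]` and comparison with the counting series.

open Avoiders
  using (indicator; indicator-yes; indicator-no; occurrences; letters; occurrences-letters;
         admissible?)
open import Defs
open import Data.Integer.Base using (+_)

module ℤ⟦y⟧-Properties = SeriesRing ℤ.+-*-commutativeRing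

-- Operations and equality of `ℤ[y]` are those of the coefficient series, so every law is
-- definitional and the ring axioms pull back from `ℤ⟦y⟧`.
coeff-isRingMonomorphism : IsRingMonomorphism ℤ[y] ℤ⟦y⟧.rawRing Polynomial.coeff
coeff-isRingMonomorphism = record
  { isRingHomomorphism = record
    { isSemiringHomomorphism = record
      { isNearSemiringHomomorphism = record
        { +-isMonoidHomomorphism = record
          { isMagmaHomomorphism = record
            { isRelHomomorphism = record { cong = id }
            ; homo = λ _ _ _ → ≡.refl
            }
          ; ε-homo = λ _ → ≡.refl
          }
        ; *-homo = λ _ _ _ → ≡.refl
        }
      ; 1#-homo = λ _ → ≡.refl
      }
    ; -‿homo = λ _ _ → ≡.refl
    }
  ; injective = id
  }

ℤ[y]-commutativeRing : CommutativeRing 0ℓ 0ℓ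
ℤ[y]-commutativeRing = record
  { isCommutativeRing = isCommutativeRing
      (CommutativeRing.isCommutativeRing ℤ⟦y⟧-Properties.commutativeRing)
  }
  where open import Algebra.Morphism.RingMonomorphism coeff-isRingMonomorphism

module ℤ[y] = CommutativeRing ℤ[y]-commutativeRing

i+i≡0⇒i≡0 : ∀ i → i ℤ.+ i ≡ ℤ.0ℤ → i ≡ ℤ.0ℤ
i+i≡0⇒i≡0 (+ n) eq = cong +_ (ℕ.m+n≡0⇒m≡0 n (ℤ.+-injective eq))

2-regular : IsNonZeroDivisor ℤ[y]-commutativeRing (ℤ[y].1# ℤ[y].+ ℤ[y].1#)
2-regular p 2p≈0 r = i+i≡0⇒i≡0 (Polynomial.coeff p r)
  (≡.trans (≡.sym (*-1+1 ℤ[y]-commutativeRing p r)) (2p≈0 r))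

-- As `y` is a constant series in `x`, `y 0` is the indeterminate of `ℤ[y]`.
open GeneratingFunctions ℤ[y]-commutativeRing (y 0)
  using (f; g; e; f-equation; g-equation; e-equation)
open Weights ℤ[y]-commutativeRing (y 0) using (weight)
open import Algebra.Properties.Semiring.Exp ℤ[y].semiring using () renaming (_^_ to _^ᵖ_)

coeff-y^ : ∀ k r → Polynomial.coeff (y 0 ^ᵖ k) r ≡ + indicator (k ℕ.≟ r)
coeff-y^ zero    zero    = ≡.refl
coeff-y^ zero    (suc r) = ≡.refl
coeff-y^ (suc k) zero    = ℤ⟦y⟧-Properties.indeterminate-⊛₀ (Polynomial.coeff (y 0 ^ᵖ k))
coeff-y^ (suc k) (suc r) = ≡.trans
  (ℤ⟦y⟧-Properties.tail-indeterminate-⊛ (Polynomial.coeff (y 0 ^ᵖ k)) r)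
  (coeff-y^ k r)

module _ {a p q} {A : Set a} {P : A → Set p} {Q : A → Set q}
         (P? : ∀ v → Dec (P v)) (Q? : ∀ v → Dec (Q v))
         {φ : A → List ℕ} {s : List ℕ → ℕ} {r : ℕ}
         (Q⇒P : ∀ {v} → Q v → P v)
         (Q⇒≡ : ∀ {v} → Q v → s (φ v) ≡ r)
         (P∧≡⇒Q : ∀ {v} → P v → s (φ v) ≡ r → Q v)
  where

  -- By the hypotheses, `Q` is `P` together with the statistic being `r`. A word satisfying `P`
  -- contributes a power of the indeterminate, with coefficient 1 at `r` if `Q` holds and 0
  -- otherwise.
  coeff-weight : ∀ vs → Polynomial.coeff (weight s (map φ (List.filter P? vs))) r
                          ≡ + length (List.filter Q? vs)
  coeff-weight []       = ≡.refl
  coeff-weight (v ∷ vs) with P? v | Q? v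
  ... | yes _  | yes qv = cong₂ ℤ._+_
    (≡.trans (coeff-y^ (s (φ v)) r) (cong +_ (indicator-yes (s (φ v) ℕ.≟ r) (Q⇒≡ qv))))
    (coeff-weight vs)
  ... | yes pv | no ¬qv = ≡.trans
    (cong₂ ℤ._+_
      (≡.trans (coeff-y^ (s (φ v)) r) (cong +_ (indicator-no (s (φ v) ℕ.≟ r) (¬qv ∘ P∧≡⇒Q pv))))
      (coeff-weight vs))
    (ℤ.+-identityˡ _)
  ... | no ¬pv | yes qv = contradiction (Q⇒P qv) ¬pv
  ... | no _   | no _   = coeff-weight vs

opaque
  unfolding Avoiders.avoiders

  -- Once unfolded, `avoiders n` filters the same `allVecs n n` as `f₃₁₂ r n`, by `admissible?` in
  -- place of `counted? r`.
  F₃₁₂≈f : F₃₁₂ ≈ f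
  F₃₁₂≈f n r = ≡.sym (coeff-weight admissible? (counted? r)
    (λ (π! , av , _) → π! , av , ≡.refl)
    (λ {π} (_ , _ , occ≡r) → ≡.trans (occurrences-letters π) occ≡r)
    (λ {π} (π! , av , _) occ≡r → π! , av , ≡.trans (≡.sym (occurrences-letters π)) occ≡r)
    (allVecs n n))

isCommutativeRing : IsCommutativeRing _≈_ _+_ _*_ -_ 0# 1#
isCommutativeRing =
  CommutativeRing.isCommutativeRing (SeriesRing.commutativeRing ℤ[y]-commutativeRing)

-- The equations, restated with the operations that quadraticFormula is applied to.
f-equation′ : f ≈ 1# + x * (f * g)
f-equation′ = f-equation

g-equation′ : g ≈ 1# + x * (e * g)
g-equation′ = g-equation

e-equation′ : e ≈ g + x * (y - 1#)
e-equation′ = e-equation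

theorem3p4 : ∃[ √Δ ]
    √Δ IsSquareRootOf
    (1# + 2 · x ^ 2 - 2 · x ^ 2 * y + x ^ 4 - 2 · x ^ 4 * y + x ^ 4 * y ^ 2 - 4 · x)
    ×
    F₃₁₂ IsQuotientOf (1# - x ^ 2 + x ^ 2 * y - √Δ) By (2 · x * (1# + x * y - x))
theorem3p4 = quadraticFormula {equal = _≈_} {_+_} {_*_} { -_} {0#} {1#} {_-_} {_·_} {_^_}
  isCommutativeRing ≡.refl ≡.refl ≡.refl {x} {y} {f} {g} {e} {F₃₁₂}
  HasConstantTerm1
  (λ {a} {b} → HasConstantTerm1-resp {a} {b})
  HasConstantTerm1-1+x*
  (λ {a} {b} → HasConstantTerm1-⊞-nonZeroDivisor 2-regular {a} {b})
  indeterminate-nonZeroDivisor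
  F₃₁₂≈f
  f-equation′
  g-equation′
  e-equation′
  where open SeriesRing ℤ[y]-commutativeRing
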